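{- Let $n\ge 1$, $V=\{1,\dots,n\}$, and let $\mathcal H\subseteq 2^V$ be a symmetric hypergraph (with $\mathcal H\neq\emptyset$ and $\emptyset\notin\mathcal H$). Then $\mathcal H$ is a JM hypergraph if and only if $\mathcal H$ is minimal transversal-free and $n\ge 3$.
   Context: Hypergraph NIM: given $\mathcal H\subseteq 2^V$ with $\mathcal H\neq\emptyset$, $\emptyset\notin\mathcal H$, positions are vectors $x\in\mathbb Z_{\ge 0}^V$ ($x_i$ = number of stones in pile $i$). A move $x\to x'$ consists of choosing $H\in\mathcal H$ and strictly decreasing every coordinate $x_i$, $i\in H$ (to any nonnegative values), leaving the others unchanged; i.e. $\{i: x'_i<x_i\}\in\mathcal H$ and $x'_i\le x_i$ for all $i$. Two players alternate; the player unable to move loses. This game is $NIM_{\mathcal H}$. Its Sprague–Grundy function is $\mathcal G_{\mathcal H}(x)=\mathrm{mex}\{\mathcal G_{\mathcal H}(x'): x\to x'\}$, where $\mathrm{mex}(S)$ is the least nonnegative integer not in $S$. The Tetris value $\mathcal T_{\mathcal H}(x)$ is the maximum number of consecutive moves that can be made in $NIM_{\mathcal H}$ starting from $x$ (equivalently, the maximum length of a sequence of moves each of which decreases the coordinates of some hyperedge by exactly 1). Let $e$ be the all-ones vector and define $m(x)=\min_{i\in V}x_i$, $y_{\mathcal H}(x)=\mathcal T_{\mathcal H}(x-m(x)e)+1$, $v_{\mathcal H}(x)=\binom{y_{\mathcal H}(x)}{2}+\left(\left(m(x)-\binom{y_{\mathcal H}(x)}{2}-1\right)\bmod y_{\mathcal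 H}(x)\right)$, and $\mathcal U_{\mathcal H}(x)=\mathcal T_{\mathcal H}(x)$ if $m(x)\le\binom{y_{\mathcal H}(x)}{2}$, and $\mathcal U_{\mathcal H}(x)=v_{\mathcal H}(x)$ otherwise. $\mathcal H$ is called JM if $\mathcal G_{\mathcal H}(x)=\mathcal U_{\mathcal H}(x)$ for all $x\in\mathbb Z_{\ge0}^V$. $\mathcal H$ is symmetric if $H\in\mathcal H$ implies every subset of $V$ of size $|H|$ is in $\mathcal H$. A set $T\subseteq V$ is a transversal of $\mathcal H$ if $T\cap H\neq\emptyset$ for all $H\in\mathcal H$. $\mathcal H$ is transversal-free if no hyperedge $H\in\mathcal H$ is a transversal of $\mathcal H$. For $S\subseteq V$, the induced subhypergraph is $\mathcal H_S=\{H\in\mathcal H: H\subseteq S\}$. $\mathcal H$ is minimal transversal-free if it is transversal-free and every nonempty proper induced subhypergraph $\mathcal H_S$ ($S\subsetneq V$, $\mathcal H_S\ne\emptyset$) is not transversal-free. -}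

module Defs where

open import Data.Bool using (Bool; true; false; _∧_; if_then_else_)
open import Data.Nat using (ℕ; zero; suc; _+_; _∸_; _⊔_; _⊓_; _≤_; _≤ᵇ_; _≡ᵇ_; _%_)
open import Data.Nat.Combinatorics using (_C_)
open import Data.List using (List; []; _∷_; map; concatMap; foldr; upTo; filter; length)
open import Data.Bool.ListAction using (any)
open import Data.Vec using (Vec; []; _∷_)
open import Data.Fin using (Fin)
open import Data.Fin.Subset using (Subset; inside; outside; _∩_; Nonempty; ⊤; _⊆_)
open import Data.Fin.Subset.Properties using (_⊆?_)
open import Data.Product using (_×_; ∃)
open import Relation.Binary.PropositionalEquality using (_≡_)
open import Relation.Nullary using (¬_)
open import Relation.Nullary.Decidable using (⌊_⌋)

Hypergraph : ℕ → Set
Hypergraph n = Subset n → Bool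

Position : ℕ → Set
Position n = Vec ℕ n

allSubsets : ∀ n → List (Subset n)
allSubsets zero = [] ∷ []
allSubsets (suc n) = concatMap (λ s → (inside ∷ s) ∷ (outside ∷ s) ∷ []) (allSubsets n)

edges : ∀ {n} → Hypergraph n → List (Subset n)
edges {n} H = filter (λ A → H A Data.Bool.≟ true) (allSubsets n)
  where import Data.Bool

decreases : ∀ {n} → Subset n → Position n → List (Position n)
decreases [] [] = [] ∷ []
decreases (inside ∷ A) (x ∷ xs) =
  concatMap (λ v → map (v ∷_) (decreases A xs)) (upTo x)
decreases (outside ∷ A) (x ∷ xs) = map (x ∷_) (decreases A xs)

moves : ∀ {n} → Hypergraph n → Position n → List (Position n)
moves H x = concatMap (λ A → decreases A x) (edges H)

sumV : ∀ {n} → Position n → ℕ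
sumV [] = 0
sumV (x ∷ xs) = x + sumV xs

-- minimal excludant: least k not in the list (it is ≤ length)
mex : List ℕ → ℕ
mex xs = foldr (λ k acc → if any (λ y → y ≡ᵇ k) xs then acc else k) (length xs) (upTo (length xs))

-- Sprague–Grundy function, by recursion with fuel; every move (from a
-- hypergraph not containing ∅) strictly decreases sumV, so fuel suc (sumV x)
-- suffices.
grundyF : ∀ {n} → Hypergraph n → ℕ → Position n → ℕ
grundyF H zero x = 0
grundyF H (suc f) x = mex (map (grundyF H f) (moves H x))

grundy : ∀ {n} → Hypergraph n → Position n → ℕ
grundy H x = grundyF H (suc (sumV x)) x

allPos : ∀ {n} → Subset n → Position n → Bool
allPos [] [] = true
allPos (inside ∷ A) (zero ∷ xs) = false
allPos (inside ∷ A) (suc x ∷ xs) = allPos A xs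
allPos (outside ∷ A) (x ∷ xs) = allPos A xs

dec1 : ∀ {n} → Subset n → Position n → Position n
dec1 [] [] = []
dec1 (inside ∷ A) (x ∷ xs) = (x ∸ 1) ∷ dec1 A xs
dec1 (outside ∷ A) (x ∷ xs) = x ∷ dec1 A xs

tetrisF : ∀ {n} → Hypergraph n → ℕ → Position n → ℕ
tetrisF H zero x = 0
tetrisF H (suc f) x =
  foldr (λ A acc → (if allPos A x then suc (tetrisF H f (dec1 A x)) else 0) ⊔ acc) 0 (edges H)

tetris : ∀ {n} → Hypergraph n → Position n → ℕ
tetris H x = tetrisF H (suc (sumV x)) x

-- m(x) = min_i x_i  (value for n = 0 irrelevant)
minV : ∀ {n} → Position n → ℕ
minV [] = 0
minV (x ∷ []) = x
minV (x ∷ y ∷ ys) = x ⊓ minV (y ∷ ys)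

shift : ∀ {n} → ℕ → Position n → Position n
shift m [] = []
shift m (x ∷ xs) = (x ∸ m) ∷ shift m xs

yH : ∀ {n} → Hypergraph n → Position n → ℕ
yH H x = tetris H (shift (minV x) x)

U : ∀ {n} → Hypergraph n → Position n → ℕ
U H x =
  let m = minV x
      y = suc (yH H x)   -- y_H(x)
      c = y C 2
  in if m ≤ᵇ c then tetris H x else c + ((m ∸ c ∸ 1) % y)

JM : ∀ {n} → Hypergraph n → Set
JM H = ∀ x → grundy H x ≡ U H x

Symmetric : ∀ {n} → Hypergraph n → Set
Symmetric {n} H = ∀ (A B : Subset n) → H A ≡ true → Data.Fin.Subset.∣ A ∣ ≡ Data.Fin.Subset.∣ B ∣ → H B ≡ true
  where import Data.Fin.Subset

NonEmptyH : ∀ {n} → Hypergraph n → Set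
NonEmptyH {n} H = ∃ λ (A : Subset n) → H A ≡ true

Transversal : ∀ {n} → Hypergraph n → Subset n → Set
Transversal {n} H T = ∀ (A : Subset n) → H A ≡ true → Nonempty (T ∩ A)

TransversalFree : ∀ {n} → Hypergraph n → Set
TransversalFree {n} H = ∀ (A : Subset n) → H A ≡ true → ¬ Transversal H A

induced : ∀ {n} → Hypergraph n → Subset n → Hypergraph n
induced H S A = H A ∧ ⌊ A ⊆? S ⌋

MinimalTransversalFree : ∀ {n} → Hypergraph n → Set
MinimalTransversalFree {n} H =
  TransversalFree H ×
  (∀ (S : Subset n) → ¬ (S ≡ ⊤) → NonEmptyH (induced H S) → ¬ TransversalFree (induced H S))

{-# OPTIONS --safe #-}

-- Let a be the least hyperedge size, so that T(x) ≥ t iff a t ≤ Σᵢ min(xᵢ, t).  A symmetric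
-- hypergraph is minimal transversal-free iff its sizes are at most n − a and every window of a
-- consecutive sizes below n contains one of them.
--
-- No move preserves U: at least a piles stay outside a move, so the minimum of x bounds T
-- after the move from below, whereas the value v is always less than the minimum.
--
-- Every k < U(x) is reached: T changes by at most one when one stone is removed, so the T-values of
-- the positions in a box form an interval.  If m(x) ≤ k one aims at T(x') = k, emptying a smallest
-- pile or ever larger sets of the largest piles, where the windows provide hyperedges of suitable
-- size; if k < m(x) one aims at v(x') = k in the same way after subtracting a constant from all piles.
--
-- Conversely, U vanishes at the all-ones position, so a transversal hyperedge, which leads from it to
-- a terminal position, cannot exist; and on the indicator of a proper subset S the formula gives T,
-- so some move inside S must exhaust the hyperedges, which yields a transversal in the hypergraph
-- induced on S.
module Submission where

open import Defs
open import Data.Bool using (Bool; true; false; T; if_then_else_; _∧_; _∨_; not)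
open import Data.Bool.ListAction using (any)
import Data.Bool.Properties as Bool
open import Data.Empty using (⊥-elim)
open import Data.Fin using (Fin; zero; suc; toℕ)
import Data.Fin.Properties as Fin
open import Data.Fin.Subset using (Subset; ∣_∣; ⊥; ⊤; _∩_; Nonempty)
open import Data.Fin.Subset.Properties
  using (anySubset?; nonempty?; _⊆?_; ∣⊤∣≡n; ∣p∣≡n⇒p≡⊤; x∈p∩q⁺; x∈p∩q⁻)
open import Data.List using (List; []; _∷_; map; concatMap; foldr; upTo; applyUpTo; length)
import Data.List as List
open import Data.List.Membership.Propositional using (_∈_; _∉_; find; lose)
open import Data.List.Membership.Propositional.Properties
open import Data.List.Properties using (filter-≐)
open import Data.List.Relation.Unary.Any using (here; there; index)
open import Data.List.Relation.Unary.Any.Properties using (any⁺; any⁻; lookup-index)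
open import Data.Nat
open import Data.Nat.DivMod using (m≡m%n+[m/n]*n; m%n<n; [m+kn]%n≡m%n; m<n⇒m%n≡m; m%n≤m)
open import Data.Nat.Induction using (<-wellFounded)
open import Data.Nat.Properties
open import Data.Product using (_×_; _,_; ∃; proj₁; proj₂)
open import Data.Sum using (_⊎_; inj₁; inj₂)
open import Data.Unit using (tt)
open import Data.Vec using ([]; _∷_; lookup; tabulate)
open import Data.Vec.Properties using (tabulate∘lookup; lookup∘tabulate; tabulate-cong; lookup⇒[]=; []=⇒lookup)
open import Function using (_∘_; id)
open import Function.Bundles using (_⇔_; mk⇔)
open import Induction.WellFounded using (Acc; acc)
open import Relation.Binary.Definitions using (tri<; tri≈; tri>)
open import Relation.Binary.PropositionalEquality
open import Relation.Nullary using (¬_; Dec; yes; no)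
open import Relation.Nullary.Decidable using (⌊_⌋; _×-dec_)
open import Algebra.Properties.CommutativeMonoid.Sum +-0-commutativeMonoid
  using (sum; ∑-distrib-+; sum-cong-≗; sum-replicate-zero)

-- Sums and cardinalities

sum-mono : ∀ {n} {f g : Fin n → ℕ} → (∀ i → f i ≤ g i) → sum f ≤ sum g
sum-mono {zero} h = z≤n
sum-mono {suc n} h = +-mono-≤ (h zero) (sum-mono (h ∘ suc))

sum-strict : ∀ {n} {f g : Fin n → ℕ} → (∀ i → f i ≤ g i) → ∀ i → f i < g i → sum f < sum g
sum-strict h zero lt = +-mono-<-≤ lt (sum-mono (h ∘ suc))
sum-strict h (suc i) lt = +-mono-≤-< (h zero) (sum-strict (h ∘ suc) i lt)

sum-*ʳ : ∀ {n} (f : Fin n → ℕ) k → sum (λ i → f i * k) ≡ sum f * k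
sum-*ʳ {zero} f k = refl
sum-*ʳ {suc n} f k = trans (cong (f zero * k +_) (sum-*ʳ (f ∘ suc) k))
    (sym (*-distribʳ-+ k (f zero) (sum (f ∘ suc))))

-- Boolean functions rather than `Subset` vectors: cardinalities become sums over `Fin n` and set
-- identities are checked pointwise. `tabulate` and `lookup` pass between the two.
Pred : ℕ → Set
Pred n = Fin n → Bool

infix 4 _∋_ _∌_ _⊑_

_∋_ _∌_ : ∀ {n} → Pred n → Fin n → Set
p ∋ i = p i ≡ true
p ∌ i = p i ≡ false

_⊑_ : ∀ {n} → Pred n → Pred n → Set
p ⊑ q = ∀ i → p ∋ i → q ∋ i

∌⇒¬∋ : ∀ {n} (p : Pred n) {i} → p ∌ i → ¬ (p ∋ i)
∌⇒¬∋ p e e′ with () ← trans (sym e) e′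

¬∋⇒∌ : ∀ {n} (p : Pred n) {i} → ¬ (p ∋ i) → p ∌ i
¬∋⇒∌ p {i} h with p i
... | true = ⊥-elim (h refl)
... | false = refl

∋-or-∌ : ∀ {n} (p : Pred n) i → p ∋ i ⊎ p ∌ i
∋-or-∌ p i with p i
... | true = inj₁ refl
... | false = inj₂ refl

⟦_⟧ : Bool → ℕ
⟦ true ⟧ = 1
⟦ false ⟧ = 0

card : ∀ {n} → Pred n → ℕ
card p = sum (λ i → ⟦ p i ⟧)

card-∣∣ : ∀ {n} (p : Pred n) → ∣ tabulate p ∣ ≡ card p
card-∣∣ {zero} p = refl
card-∣∣ {suc n} p with p zero
... | true = cong suc (card-∣∣ (p ∘ suc))
... | false = card-∣∣ (p ∘ suc)

card-lookup : ∀ {n} (A : Subset n) → card (lookup A) ≡ ∣ A ∣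
card-lookup A = trans (sym (card-∣∣ (lookup A))) (cong ∣_∣ (tabulate∘lookup A))

card-cong : ∀ {n} {p q : Pred n} → (∀ i → p i ≡ q i) → card p ≡ card q
card-cong h = sum-cong-≗ (λ i → cong ⟦_⟧ (h i))

⟦⟧-mono : ∀ b c → (b ≡ true → c ≡ true) → ⟦ b ⟧ ≤ ⟦ c ⟧
⟦⟧-mono false c h = z≤n
⟦⟧-mono true c h rewrite h refl = ≤-refl

card-mono : ∀ {n} {p q : Pred n} → p ⊑ q → card p ≤ card q
card-mono h = sum-mono (λ i → ⟦⟧-mono _ _ (h i))

card-strict : ∀ {n} {p q : Pred n} → p ⊑ q → ∀ {i} → p ∌ i → q ∋ i → card p < card q
card-strict {p = p} {q} h {i} e e′ = sum-strict (λ j → ⟦⟧-mono _ _ (h j))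
    i (subst₂ (λ b c → ⟦ b ⟧ < ⟦ c ⟧) (sym e) (sym e′) ≤-refl)

card-+ : ∀ {n} (p q r : Pred n) → (∀ i → ⟦ p i ⟧ + ⟦ q i ⟧ ≡ ⟦ r i ⟧) → card p + card q ≡ card r
card-+ p q r h = trans (sym (∑-distrib-+ (λ i → ⟦ p i ⟧) (λ i → ⟦ q i ⟧))) (sum-cong-≗ h)

∁ : ∀ {n} → Pred n → Pred n
∁ p i = not (p i)

_∖_ _∪_ : ∀ {n} → Pred n → Pred n → Pred n
(p ∖ q) i = p i ∧ not (q i)
(p ∪ q) i = p i ∨ q i

full : ∀ {n} → Pred n
full i = true

card-full : ∀ n → card (full {n}) ≡ n
card-full zero = refl
card-full (suc n) = cong suc (card-full n)

card-∁ : ∀ {n} (p : Pred n) → card p + card (∁ p) ≡ n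
card-∁ {n} p = trans (card-+ p (∁ p) full (λ i → aux (p i))) (card-full n)
  where
  aux : ∀ b → ⟦ b ⟧ + ⟦ not b ⟧ ≡ 1
  aux true = refl
  aux false = refl

card-∖ : ∀ {n} (p q : Pred n) → q ⊑ p → card q + card (p ∖ q) ≡ card p
card-∖ p q h = card-+ q (p ∖ q) p (λ i → aux (p i) (q i) (h i))
  where
  aux : ∀ b c → (c ≡ true → b ≡ true) → ⟦ c ⟧ + ⟦ b ∧ not c ⟧ ≡ ⟦ b ⟧
  aux true true h = refl
  aux true false h = refl
  aux false true h with () ← h refl
  aux false false h = refl

card-≤n : ∀ {n} (p : Pred n) → card p ≤ n
card-≤n {n} p = subst (card p ≤_) (card-∁ p) (m≤m+n _ _)

∅ : ∀ {n} → Pred n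
∅ i = false

card-∅ : ∀ n → card (∅ {n}) ≡ 0
card-∅ n = sum-replicate-zero n

single : ∀ {n} → Fin n → Pred n
single i j = ⌊ i Fin.≟ j ⌋

∋-single : ∀ {n} (i : Fin n) → single i ∋ i
∋-single i with i Fin.≟ i
... | yes _ = refl
... | no ne = ⊥-elim (ne refl)

single-≡ : ∀ {n} {i j : Fin n} → single i ∋ j → i ≡ j
single-≡ {i = i} {j} e with i Fin.≟ j
... | yes eq = eq

card-single : ∀ {n} (i : Fin n) → card (single i) ≡ 1
card-single {suc n} zero = cong suc (card-∅ n)
card-single {suc n} (suc i) = trans (card-cong aux) (card-single i)
  where
  aux : ∀ j → single (suc i) (suc j) ≡ single i j
  aux j with i Fin.≟ j
  ... | yes _ = refl
  ... | no _ = refl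

insert : ∀ {n} → Fin n → Pred n → Pred n
insert i p = p ∪ single i

∋-∪ˡ : ∀ {n} (p q : Pred n) → p ⊑ p ∪ q
∋-∪ˡ p q i e rewrite e = refl

∋-∪ʳ : ∀ {n} (p q : Pred n) → q ⊑ p ∪ q
∋-∪ʳ p q i e with p i
... | true = refl
... | false = e

∪-elim : ∀ {n} (p q : Pred n) {i} → p ∪ q ∋ i → p ∋ i ⊎ q ∋ i
∪-elim p q {i} e with p i
... | true = inj₁ refl
... | false = inj₂ e

∖-intro : ∀ {n} (p q : Pred n) {i} → p ∋ i → q ∌ i → p ∖ q ∋ i
∖-intro p q e e′ rewrite e | e′ = refl

∖-elim : ∀ {n} (p q : Pred n) {i} → p ∖ q ∋ i → p ∋ i × q ∌ i
∖-elim p q {i} e with p i | q i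
... | true | false = refl , refl

∁-intro : ∀ {n} (p : Pred n) {i} → p ∌ i → ∁ p ∋ i
∁-intro p e rewrite e = refl

∁-elim : ∀ {n} (p : Pred n) {i} → ∁ p ∋ i → p ∌ i
∁-elim p {i} e with p i
... | false = refl

∋-insert : ∀ {n} (i : Fin n) (p : Pred n) → insert i p ∋ i
∋-insert i p = ∋-∪ʳ p (single i) i (∋-single i)

card-insert : ∀ {n} (i : Fin n) (p : Pred n) → p ∌ i → card (insert i p) ≡ suc (card p)
card-insert i p e = trans (sym (card-+ p (single i) (insert i p) pt))
    (trans (cong (card p +_) (card-single i)) (+-comm (card p) 1))
  where
  pt : ∀ j → ⟦ p j ⟧ + ⟦ single i j ⟧ ≡ ⟦ insert i p j ⟧
  pt j with p j in eq | i Fin.≟ j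
  ... | true | yes refl = ⊥-elim (∌⇒¬∋ p e eq)
  ... | true | no _ = refl
  ... | false | _ = refl

card>0 : ∀ {n} (p : Pred n) → 0 < card p → ∃ λ i → p ∋ i
card>0 {suc n} p h with p zero in eq
... | true = zero , eq
... | false with i , e ← card>0 (p ∘ suc) h = suc i , e

card-∋ : ∀ {n} (p : Pred n) {i} → p ∋ i → 0 < card p
card-∋ {n} p {i} e = <-≤-trans z<s (≤-trans (≤-reflexive (sym (card-single i)))
  (card-mono {p = single i} λ k s → trans (cong p (sym (single-≡ {i = i} s))) e))

card-gap : ∀ {n} (p : Pred n) → card p < n → ∃ λ i → p ∌ i
card-gap {n} p h = let i , e = card>0 (∁ p) pos in i , ∁-elim p e
  where
  pos : 0 < card (∁ p)
  pos = +-cancelˡ-< (card p) 0 _ (subst₂ _<_ (sym (+-identityʳ _)) (sym (card-∁ p)) h)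

argmax : ∀ {n} (f : Fin n → ℕ) (p : Pred n) → (∃ λ i → p ∋ i) → ∃ λ i → p ∋ i × (∀ j → p ∋ j → f j ≤ f i)
argmax {zero} f p (() , _)
argmax {suc n} f p (i , e) with 0 <? card (p ∘ suc)
argmax {suc n} f p (zero , e) | no ¬pos = zero , e ,
  λ { zero _ → ≤-refl ; (suc j) e′ → ⊥-elim (¬pos (card-∋ (p ∘ suc) e′)) }
argmax {suc n} f p (suc i , e) | no ¬pos = ⊥-elim (¬pos (card-∋ (p ∘ suc) e))
argmax {suc n} f p _ | yes pos with i , e , h ← argmax (f ∘ suc) (p ∘ suc) (card>0 (p ∘ suc) pos)
    with ∋-or-∌ p zero
... | inj₂ e₀ = suc i , e , λ { zero e′ → ⊥-elim (∌⇒¬∋ p e₀ e′) ; (suc j) e′ → h j e′ }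
... | inj₁ e₀ with f (suc i) ≤? f zero
... | yes le = zero , e₀ , λ { zero _ → ≤-refl ; (suc j) e′ → ≤-trans (h j e′) le }
... | no gt = suc i , e , λ { zero _ → ≰⇒≥ gt ; (suc j) e′ → h j e′ }

argmin : ∀ {n} (f : Fin n → ℕ) (p : Pred n) → (∃ λ i → p ∋ i) → ∃ λ i → p ∋ i × (∀ j → p ∋ j → f i ≤ f j)
-- Complementing in the overall maximum `f M` turns the minimum into a maximum; `hM` makes the
-- truncated subtraction reversible.
argmin {n} f p ex with M , _ , hM ← argmax f full (proj₁ ex , refl) with i , e , h ← argmax
    (λ j → f M ∸ f j) p ex =
  i , e , λ j e′ → subst₂ _≤_ (m∸[m∸n]≡n (hM i refl)) (m∸[m∸n]≡n (hM j refl)) (∸-monoʳ-≤ (f M) (h j e′))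

-- Sprague–Grundy functions

first : (ℕ → Bool) → ℕ → List ℕ → ℕ
first p = foldr (λ k acc → if p k then acc else k)

first-spec : ∀ (p : ℕ → Bool) N (f : ℕ → ℕ) l → 
  (first p N (applyUpTo f l) ≡ N × (∀ i → i < l → p (f i) ≡ true)) ⊎
  (∃ λ i → first p N (applyUpTo f l) ≡ f i × p (f i) ≡ false × (∀ j → j < i → p (f j) ≡ true))
first-spec p N f zero = inj₁ (refl , λ _ ())
first-spec p N f (suc l) with p (f 0) in eq
... | false = inj₂ (0 , refl , eq , λ _ ())
... | true with first-spec p N (f ∘ suc) l
... | inj₁ (e , h) = inj₁ (e , λ { zero _ → eq ; (suc i) (s≤s lt) → h i lt })
... | inj₂ (i , e , e′ , h) = inj₂ (suc i , e , e′ , λ { zero _ → eq ; (suc j) (s≤s lt) → h j lt })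

any-≡ᵇ⁻ : ∀ xs k → any (λ y → y ≡ᵇ k) xs ≡ true → k ∈ xs
any-≡ᵇ⁻ xs k e with y , y∈ , t ← find (any⁻ (λ y → y ≡ᵇ k) xs (subst T (sym e) tt)) = subst (_∈ xs)
    (≡ᵇ⇒≡ y k t) y∈

any-≡ᵇ⁺ : ∀ xs k → k ∈ xs → any (λ y → y ≡ᵇ k) xs ≡ true
any-≡ᵇ⁺ xs k k∈ with any (λ y → y ≡ᵇ k) xs | any⁺ {xs = xs} (λ y → y ≡ᵇ k) (lose k∈ (≡⇒≡ᵇ k k refl))
... | true | _ = refl

-- Otherwise all the numbers from 0 to `length xs` would have an index in the list, and by the
-- pigeonhole principle two of them would share one. This justifies the default value of `mex`.
long-∉ : ∀ (xs : List ℕ) → (∀ i → i < length xs → i ∈ xs) → length xs ∉ xs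
long-∉ xs h l∈ = let i , j , i<j , e = Fin.pigeonhole (n<1+n (length xs)) (index ∘ mem) in
  <⇒≢ i<j (trans (lookup-index (mem i)) (trans (cong (List.lookup xs) e) (sym (lookup-index (mem j)))))
  where
  mem : ∀ (i : Fin (suc (length xs))) → toℕ i ∈ xs
  mem i with m≤n⇒m<n∨m≡n (≤-pred (Fin.toℕ<n i))
  ... | inj₁ lt = h _ lt
  ... | inj₂ eq = subst (_∈ xs) (sym eq) l∈

mex-spec : ∀ xs → mex xs ∉ xs × (∀ k → k < mex xs → k ∈ xs)
mex-spec xs with first-spec (λ k → any (λ y → y ≡ᵇ k) xs) (length xs) id (length xs)
... | inj₁ (e , h) = subst (_∉ xs) (sym e) (long-∉ xs all) , λ k lt → all k (subst (k <_) e lt)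
  where
  all : ∀ i → i < length xs → i ∈ xs
  all i lt = any-≡ᵇ⁻ xs i (h i lt)
... | inj₂ (i , e , e′ , h) = subst (_∉ xs) (sym e) (λ i∈ → case-⊥ (trans (sym e′) (any-≡ᵇ⁺ xs i i∈))) ,
  λ k lt → any-≡ᵇ⁻ xs k (h k (subst (k <_) e lt))
  where
  case-⊥ : false ≡ true → _
  case-⊥ ()

-- Moves as a relation on positions

supp : ∀ {n} → Position n → Position n → Pred n
supp x w i = lookup w i <ᵇ lookup x i

supp-∋ : ∀ {n} (x w : Position n) {i} → lookup w i < lookup x i → supp x w ∋ i
supp-∋ x w {i} lt with lookup w i <ᵇ lookup x i | <⇒<ᵇ lt
... | true | _ = refl

∋-supp : ∀ {n} (x w : Position n) {i} → supp x w ∋ i → lookup w i < lookup x i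
∋-supp x w {i} e = <ᵇ⇒< _ _ (subst T (sym e) tt)

∌-supp : ∀ {n} (x w : Position n) {i} → supp x w ∌ i → lookup x i ≤ lookup w i
∌-supp x w e = ≮⇒≥ λ lt → ∌⇒¬∋ (supp x w) e (supp-∋ x w lt)

-- Equivalent to membership in `moves`; the hyperedge is recovered as the set of piles that became
-- smaller.
Move : ∀ {n} → Hypergraph n → Position n → Position n → Set
Move H x w = (∀ i → lookup w i ≤ lookup x i) × H (tabulate (supp x w)) ≡ true

∈-allSubsets : ∀ {n} (A : Subset n) → A ∈ allSubsets n
∈-allSubsets [] = here refl
∈-allSubsets {suc n} (b ∷ A) = ∈-concatMap⁺ (λ s → (true ∷ s) ∷ (false ∷ s) ∷ []) {xs = allSubsets n}
    (lose (∈-allSubsets A) (mem b))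
  where
  mem : ∀ b → (b ∷ A) ∈ (true ∷ A) ∷ (false ∷ A) ∷ []
  mem true = here refl
  mem false = there (here refl)

∈-edges⁺ : ∀ {n} (H : Hypergraph n) {A} → H A ≡ true → A ∈ edges H
∈-edges⁺ H {A} e = ∈-filter⁺ (λ A → H A Bool.≟ true) (∈-allSubsets A) e

∈-edges⁻ : ∀ {n} (H : Hypergraph n) {A} → A ∈ edges H → H A ≡ true
∈-edges⁻ {n} H A∈ = proj₂ (∈-filter⁻ (λ A → H A Bool.≟ true) {xs = allSubsets n} A∈)

decreases⁺ : ∀ {n} (x w : Position n) → (∀ i → lookup w i ≤ lookup x i) → w ∈ decreases (tabulate (supp x w)) x
decreases⁺ [] [] le = here refl
decreases⁺ (x ∷ xs) (w ∷ ws) le with w <ᵇ x in eq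
... | true = ∈-concatMap⁺ (λ v → map (v ∷_) (decreases (tabulate (supp xs ws)) xs)) {xs = upTo x}
    (lose (∈-upTo⁺ (<ᵇ⇒< w x (subst T (sym eq) tt)))
                (∈-map⁺ (w ∷_) (decreases⁺ xs ws (le ∘ suc))))
... | false with refl ← ≤-antisym (le zero) (≮⇒≥ λ lt → subst T eq (<⇒<ᵇ lt)) = ∈-map⁺ (w ∷_)
    (decreases⁺ xs ws (le ∘ suc))

decreases⁻ : ∀ {n} (A : Subset n) (x w : Position n) → w ∈ decreases A x →
  (∀ i → lookup w i ≤ lookup x i) × A ≡ tabulate (supp x w)
decreases⁻ [] [] [] w∈ = (λ ()) , refl
decreases⁻ (true ∷ A) (x ∷ xs) w w∈
  with v , v∈ , w∈′ ← find (∈-concatMap⁻ (λ v → map (v ∷_) (decreases A xs)) {xs = upTo x} w∈)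
  with ws , ws∈ , refl ← ∈-map⁻ (v ∷_) w∈′
  with le , e ← decreases⁻ A xs ws ws∈ =
  (λ { zero → <⇒≤ (∈-upTo⁻ v∈) ; (suc i) → le i }) ,
  cong₂ _∷_ (sym (supp-∋ (x ∷ xs) (v ∷ ws) {zero} (∈-upTo⁻ v∈))) e
decreases⁻ (false ∷ A) (x ∷ xs) w w∈
  with ws , ws∈ , refl ← ∈-map⁻ (x ∷_) w∈
  with le , e ← decreases⁻ A xs ws ws∈ =
  (λ { zero → ≤-refl ; (suc i) → le i }) ,
  cong₂ _∷_ (sym (¬∋⇒∌ (supp (x ∷ xs) (x ∷ ws)) {zero} (λ e → <-irrefl refl (∋-supp (x ∷ xs) (x ∷ ws)
      {zero} e)))) e

∈-moves⁺ : ∀ {n} (H : Hypergraph n) {x w} → Move H x w → w ∈ moves H x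
∈-moves⁺ H {x} {w} (le , e) = ∈-concatMap⁺ (λ A → decreases A x) {xs = edges H} (lose (∈-edges⁺ H e)
    (decreases⁺ x w le))

∈-moves⁻ : ∀ {n} (H : Hypergraph n) {x w} → w ∈ moves H x → Move H x w
∈-moves⁻ H {x} {w} w∈
  with A , A∈ , w∈′ ← find (∈-concatMap⁻ (λ A → decreases A x) {xs = edges H} w∈)
  with le , refl ← decreases⁻ A x w w∈′ = le , ∈-edges⁻ H A∈

sumV-sum : ∀ {n} (x : Position n) → sumV x ≡ sum (lookup x)
sumV-sum [] = refl
sumV-sum (x ∷ xs) = cong (x +_) (sumV-sum xs)

tabulate-∅ : ∀ {n} (p : Pred n) → (∀ i → p ∌ i) → tabulate p ≡ ⊥
tabulate-∅ {zero} p h = refl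
tabulate-∅ {suc n} p h = cong₂ _∷_ (h zero) (tabulate-∅ (p ∘ suc) (h ∘ suc))

edge-nonempty : ∀ {n} (H : Hypergraph n) → H ⊥ ≡ false → ∀ p → H (tabulate p) ≡ true → 0 < card p
edge-nonempty H H⊥ p e = ≰⇒> λ le → contra (trans (sym H⊥)
    (trans (cong H (sym (tabulate-∅ p λ i → ¬∋⇒∌ p λ e′ → <⇒≱ (card-∋ p e′) le))) e))
  where
  contra : ¬ (false ≡ true)
  contra ()

move-sumV : ∀ {n} (H : Hypergraph n) → H ⊥ ≡ false → ∀ {x w} → Move H x w → sumV w < sumV x
move-sumV H H⊥ {x} {w} (le , e) with i , i∈ ← card>0 (supp x w) (edge-nonempty H H⊥ _ e) =
  subst₂ _<_ (sym (sumV-sum w)) (sym (sumV-sum x)) (sum-strict le i (∋-supp x w i∈))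

-- The two properties that determine a mex, so that a candidate function can be verified without
-- computing one.
IsSpragueGrundy : ∀ {n} → Hypergraph n → (Position n → ℕ) → Set
IsSpragueGrundy H g = (∀ x w → Move H x w → g w ≢ g x) × (∀ x k → k < g x → ∃ λ w → Move H x w × g w ≡ k)

mex-map-cong : ∀ {A : Set} (g h : A → ℕ) xs → (∀ y → y ∈ xs → g y ≡ h y) → mex (map g xs) ≡ mex (map h xs)
mex-map-cong g h xs eq = cong mex (map-cong-∈ xs eq)
  where
  map-cong-∈ : ∀ xs → (∀ y → y ∈ xs → g y ≡ h y) → map g xs ≡ map h xs
  map-cong-∈ [] eq = refl
  map-cong-∈ (x ∷ xs) eq = cong₂ _∷_ (eq x (here refl)) (map-cong-∈ xs λ y → eq y ∘ there)

module _ {n : ℕ} (H : Hypergraph n) (H⊥ : H ⊥ ≡ false) where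

  -- Every move lowers `sumV`, so neither recursion runs out of fuel.
  grundyF-fuel : ∀ f f′ x → sumV x < f → sumV x < f′ → grundyF H f x ≡ grundyF H f′ x
  grundyF-fuel (suc f) (suc f′) x (s≤s lt) (s≤s lt′) = mex-map-cong _ _ (moves H x) λ y y∈ →
    let d = move-sumV H H⊥ {x} {y} (∈-moves⁻ H y∈) in
    grundyF-fuel f f′ y (<-≤-trans d lt) (<-≤-trans d lt′)

  grundy-mex : ∀ x → grundy H x ≡ mex (map (grundy H) (moves H x))
  grundy-mex x = mex-map-cong _ _ (moves H x) λ y y∈ →
    grundyF-fuel (sumV x) (suc (sumV y)) y (move-sumV H H⊥ {x} {y} (∈-moves⁻ H y∈)) ≤-refl

  grundy-isSpragueGrundy : IsSpragueGrundy H (grundy H)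
  grundy-isSpragueGrundy =
    (λ x w mv e → proj₁ (mex-spec (map (grundy H) (moves H x)))
      (subst (_∈ map (grundy H) (moves H x)) (trans e (grundy-mex x))
          (∈-map⁺ (grundy H) (∈-moves⁺ H {x} {w} mv)))) ,
    λ x k lt → let w , w∈ , e = ∈-map⁻ (grundy H) (proj₂ (mex-spec (map (grundy H) (moves H x)))
                     k (subst (k <_) (grundy-mex x) lt))
               in w , ∈-moves⁻ H w∈ , sym e

  -- Where the values differ, the function with the larger value reaches the smaller one by a move.
  -- By induction on `sumV` both functions agree there, so the other one would repeat its value
  -- along a move.
  sg-unique : ∀ {g h} → IsSpragueGrundy H g → IsSpragueGrundy H h → ∀ x → g x ≡ h x
  sg-unique {g} {h} (g≢ , g<) (h≢ , h<) x = go x (<-wellFounded (sumV x))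
    where
    go : ∀ x → Acc _<_ (sumV x) → g x ≡ h x
    go x (acc rs) with <-cmp (g x) (h x)
    ... | tri≈ _ e _ = e
    ... | tri< lt _ _ with w , mv , e ← h< x (g x) lt =
        ⊥-elim (g≢ x w mv (trans (go w (rs (move-sumV H H⊥ {x} {w} mv))) e))
    ... | tri> _ _ gt with w , mv , e ← g< x (h x) gt =
        ⊥-elim (h≢ x w mv (trans (sym (go w (rs (move-sumV H H⊥ {x} {w} mv)))) e))

-- The Tetris value

-- The sets of `card S` largest piles, with ties broken arbitrarily.
Top : ∀ {n} → Position n → Pred n → Set
Top x S = ∀ i j → S ∋ i → S ∌ j → lookup x j ≤ lookup x i

Top-∅ : ∀ {n} (x : Position n) → Top x ∅
Top-∅ x i j () _

Top-insert : ∀ {n} (x : Position n) (S : Pred n) {i} → Top x S → S ∌ i →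
  (∀ j → S ∌ j → lookup x j ≤ lookup x i) → Top x (insert i S)
Top-insert x S {i} top i∌ max k j k∈ j∌ with ∪-elim S (single i) k∈
... | inj₁ k∈S = top k j k∈S (¬∋⇒∌ S (∌⇒¬∋ (insert i S) j∌ ∘ ∋-∪ˡ S (single i) j))
... | inj₂ k∈i rewrite sym (single-≡ {i = i} k∈i) = max j (¬∋⇒∌ S (∌⇒¬∋ (insert i S) j∌ ∘ ∋-∪ˡ S (single i) j))

grow : ∀ {n} (x : Position n) (S : Pred n) → Top x S → card S < n → ∃ λ i → S ∌ i × Top x (insert i S)
grow x S top lt with i , i∈ , max ← argmax (lookup x) (∁ S) (let i , i∌ = card-gap S lt in i , ∁-intro S i∌) =
  i , ∁-elim S i∈ , Top-insert x S top (∁-elim S i∈) (λ j j∌ → max j (∁-intro S j∌))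

extend : ∀ {n} (x : Position n) (S : Pred n) → Top x S → ∀ d → card S ≤ d → d ≤ n →
  ∃ λ S′ → S ⊑ S′ × Top x S′ × card S′ ≡ d
extend x S top d le d≤n = go (d ∸ card S) S top (m+[n∸m]≡n le)
  where
  go : ∀ e S → Top x S → card S + e ≡ d → ∃ λ S′ → S ⊑ S′ × Top x S′ × card S′ ≡ d
  go zero S top eq = S , (λ _ → id) , top , trans (sym (+-identityʳ _)) eq
  go (suc e) S top eq
    with i , i∌ , top′ ← grow x S top (<-≤-trans (m<m+n (card S) z<s) (≤-trans (≤-reflexive eq) d≤n))
    with S′ , sub , top″ , c ← go e (insert i S) top′ (trans (cong (_+ e) (card-insert i S i∌))
        (trans (sym (+-suc (card S) e)) eq)) =
    S′ , (λ j → sub j ∘ ∋-∪ˡ S (single i) j) , top″ , c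

-- The supply for `t` unit moves: a pile of height `h` can take part in at most `h ⊓ t` of them.
W : ∀ {n} → ℕ → Position n → ℕ
W t x = sum (λ i → lookup x i ⊓ t)

W-mono : ∀ {n} t {x w : Position n} → (∀ i → lookup x i ≤ lookup w i) → W t x ≤ W t w
W-mono t le = sum-mono λ i → ⊓-monoˡ-≤ t (le i)

positive : ∀ {n} → Position n → Pred n
positive x i = 0 <ᵇ lookup x i

positive-∋ : ∀ {n} (x : Position n) {i} → 0 < lookup x i → positive x ∋ i
positive-∋ x {i} lt with lookup x i
positive-∋ x {i} () | zero
... | suc _ = refl

W-sparse : ∀ {n} t (x : Position n) (p : Pred n) → (∀ i → p ∌ i → lookup x i ≡ 0) → W t x ≤ card p * t
W-sparse t x p z = subst (W t x ≤_) (sum-*ʳ (λ i → ⟦ p i ⟧) t) (sum-mono pt)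
  where
  pt : ∀ i → lookup x i ⊓ t ≤ ⟦ p i ⟧ * t
  pt i with p i in eq
  ... | true = subst (lookup x i ⊓ t ≤_) (sym (+-identityʳ t)) (m⊓n≤n _ t)
  ... | false rewrite z i eq = z≤n

W-sparse-strict : ∀ {n} t (x : Position n) (p : Pred n) → (∀ i → p ∌ i → lookup x i ≡ 0) →
  ∀ {i} → p ∋ i → lookup x i < t → W t x < card p * t
W-sparse-strict t x p z {i} i∈ lt = subst (W t x <_) (sum-*ʳ (λ i → ⟦ p i ⟧) t) (sum-strict pt i st)
  where
  pt : ∀ i → lookup x i ⊓ t ≤ ⟦ p i ⟧ * t
  pt i with p i in eq
  ... | true = subst (lookup x i ⊓ t ≤_) (sym (+-identityʳ t)) (m⊓n≤n _ t)
  ... | false rewrite z i eq = z≤n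
  st : lookup x i ⊓ t < ⟦ p i ⟧ * t
  st rewrite i∈ = subst (lookup x i ⊓ t <_) (sym (+-identityʳ t)) (≤-<-trans (m⊓n≤m _ t) lt)

W-dense : ∀ {n} t (x : Position n) (p : Pred n) → (∀ i → p ∋ i → t ≤ lookup x i) → card p * t ≤ W t x
W-dense t x p h = subst (_≤ W t x) (sum-*ʳ (λ i → ⟦ p i ⟧) t) (sum-mono pt)
  where
  pt : ∀ i → ⟦ p i ⟧ * t ≤ lookup x i ⊓ t
  pt i with p i in eq
  ... | true = subst (_≤ lookup x i ⊓ t) (sym (+-identityʳ t)) (⊓-glb (h i eq) ≤-refl)
  ... | false = z≤n

-- On `p` the pile of `w` can be raised by one together with the cap without exceeding that of `x`;
-- elsewhere raising the cap loses nothing.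
W-move : ∀ {n} t (x w : Position n) (p : Pred n) → (∀ i → lookup w i ≤ lookup x i) →
    (∀ i → p ∋ i → lookup w i < lookup x i) →
  W t w + card p ≤ W (suc t) x
W-move t x w p le lt = subst (_≤ W (suc t) x) (∑-distrib-+ (λ i → lookup w i ⊓ t) (λ i → ⟦ p i ⟧)) (sum-mono pt)
  where
  pt : ∀ i → lookup w i ⊓ t + ⟦ p i ⟧ ≤ lookup x i ⊓ suc t
  pt i with p i in eq
  ... | true = subst (_≤ lookup x i ⊓ suc t) (+-comm 1 _) (⊓-monoˡ-≤ (suc t) (lt i eq))
  ... | false = subst (_≤ lookup x i ⊓ suc t) (sym (+-identityʳ _)) (⊓-mono-≤ (le i) (n≤1+n t))

-- Outside `Q` piles are not lowered and are at most `k`, so the cap `k` does not cut them; inside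
-- `Q` the loss is at most one.
W-lower : ∀ {n} k (x w : Position n) (Q : Pred n) → (∀ i → lookup x i ≤ lookup w i + ⟦ Q i ⟧) →
    (∀ i → k < lookup x i → Q ∋ i) →
  W (suc k) x ≤ W k w + card Q
W-lower k x w Q le sub = subst (W (suc k) x ≤_) (∑-distrib-+ (λ i → lookup w i ⊓ k) (λ i → ⟦ Q i ⟧))
    (sum-mono pt)
  where
  pt : ∀ i → lookup x i ⊓ suc k ≤ lookup w i ⊓ k + ⟦ Q i ⟧
  pt i with Q i in eq | le i
  ... | true | l = subst (lookup x i ⊓ suc k ≤_) (+-comm 1 _)
      (⊓-monoˡ-≤ (suc k) (subst (lookup x i ≤_) (+-comm _ 1) l))
  ... | false | l = subst (lookup x i ⊓ suc k ≤_) (sym (+-identityʳ _)) (≤-trans (m⊓n≤m (lookup x i) (suc k))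
    (⊓-glb (subst (lookup x i ≤_) (+-identityʳ _) l) (≮⇒≥ (∌⇒¬∋ Q eq ∘ sub i))))

foldr-⊔⁻ : ∀ {A : Set} (g : A → ℕ) xs {k} → k < foldr (λ y acc → g y ⊔ acc) 0 xs → ∃ λ y → y ∈ xs × k < g y
foldr-⊔⁻ g (y ∷ xs) {k} lt with <-≤-connex k (g y)
... | inj₁ lt′ = y , here refl , lt′
... | inj₂ ge with y′ , y∈ , lt′ ← foldr-⊔⁻ g xs (subst (k <_)
    (m≤n⇒m⊔n≡n (≮⇒≥ λ h → <-irrefl refl (<-≤-trans (subst (k <_) (m≥n⇒m⊔n≡m (<⇒≤ h)) lt) ge))) lt) =
        y′ , there y∈ , lt′

foldr-⊔⁺ : ∀ {A : Set} (g : A → ℕ) xs {y} → y ∈ xs → g y ≤ foldr (λ y acc → g y ⊔ acc) 0 xs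
foldr-⊔⁺ g (y ∷ xs) (here refl) = m≤m⊔n _ _
foldr-⊔⁺ g (z ∷ xs) (there y∈) = ≤-trans (foldr-⊔⁺ g xs y∈) (m≤n⊔m _ _)

allPos⁻ : ∀ {n} (A : Subset n) x → allPos A x ≡ true → ∀ i → lookup A ∋ i → 0 < lookup x i
allPos⁻ (true ∷ A) (suc x ∷ xs) e zero i∈ = z<s
allPos⁻ (true ∷ A) (suc x ∷ xs) e (suc i) i∈ = allPos⁻ A xs e i i∈
allPos⁻ (false ∷ A) (x ∷ xs) e (suc i) i∈ = allPos⁻ A xs e i i∈

allPos⁺ : ∀ {n} (A : Subset n) x → (∀ i → lookup A ∋ i → 0 < lookup x i) → allPos A x ≡ true
allPos⁺ [] [] h = refl
allPos⁺ (true ∷ A) (zero ∷ xs) h with () ← h zero refl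
allPos⁺ (true ∷ A) (suc x ∷ xs) h = allPos⁺ A xs (h ∘ suc)
allPos⁺ (false ∷ A) (x ∷ xs) h = allPos⁺ A xs (h ∘ suc)

lookup-dec1 : ∀ {n} (A : Subset n) x i → lookup (dec1 A x) i ≡ lookup x i ∸ ⟦ lookup A i ⟧
lookup-dec1 (true ∷ A) (x ∷ xs) zero = refl
lookup-dec1 (false ∷ A) (x ∷ xs) zero = refl
lookup-dec1 (true ∷ A) (x ∷ xs) (suc i) = lookup-dec1 A xs i
lookup-dec1 (false ∷ A) (x ∷ xs) (suc i) = lookup-dec1 A xs i

big : ∀ {n} → ℕ → Position n → Pred n
big k x i = k <ᵇ lookup x i

∋-big : ∀ {n} k (x : Position n) {i} → big k x ∋ i → k < lookup x i
∋-big k x {i} e = <ᵇ⇒< k (lookup x i) (subst T (sym e) tt)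

big-∋ : ∀ {n} k (x : Position n) {i} → k < lookup x i → big k x ∋ i
big-∋ k x {i} lt with k <ᵇ lookup x i | <⇒<ᵇ lt
... | true | _ = refl

-- The Tetris value depends only on the least edge size `a`: larger edges cost more stones per move.
module Tetris {n : ℕ} (H : Hypergraph n) (a : ℕ) (0<a : 0 < a)
  (edge-a : ∀ p → card p ≡ a → H (tabulate p) ≡ true)
  (min-a : ∀ p → H (tabulate p) ≡ true → a ≤ card p) where

  -- Counting criterion for `t` moves: they consume at least `a * t` stones, and no pile supplies
  -- more than `t`. `tetrisF⁻` and `tetrisF⁺` prove it necessary and sufficient.
  Feasible : ℕ → Position n → Set
  Feasible t x = a * t ≤ W t x

  feasible-sparse : ∀ {t} x → Feasible (suc t) x → ∀ p → (∀ i → p ∌ i → lookup x i ≡ 0) → a ≤ card p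
  feasible-sparse {t} x fe p z = *-cancelʳ-≤ a (card p) (suc t) (≤-trans fe (W-sparse (suc t) x p z))

  -- If `a` piles exceed `k`, they keep height `k` after losing at most one stone, and suffice
  -- alone. In the other case only the piles of `C ∪ big k x` lose when the cap falls from `k + 1`
  -- to `k`; their total loss is at most `a`, the cost of the one move given up.
  feasible-lower : ∀ {k} x w (C : Pred n) → Feasible (suc k) x → (∀ i → lookup x i ≤ lookup w i + ⟦ C i ⟧) →
    a ≤ card (big k x) ⊎ card (C ∪ big k x) ≤ a → Feasible k w
  feasible-lower {k} x w C fe le (inj₁ many) = ≤-trans (*-monoˡ-≤ k many) (W-dense k w (big k x) λ i i∈ →
    ≤-pred (≤-trans (∋-big k x i∈) (≤-trans (le i) (subst (lookup w i + ⟦ C i ⟧ ≤_) (+-comm _ 1)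
        (+-monoʳ-≤ (lookup w i) (⟦⟧-mono (C i) true λ _ → refl))))))
  feasible-lower {k} x w C fe le (inj₂ few) = +-cancelˡ-≤ a _ _ (begin
    a + a * k ≡⟨ *-suc a k ⟨
    a * suc k ≤⟨ fe ⟩
    W (suc k) x ≤⟨ W-lower k x w Q (λ i → ≤-trans (le i)
        (+-monoʳ-≤ (lookup w i) (⟦⟧-mono _ _ (∋-∪ˡ C (big k x) i))))
            (λ i lt → ∋-∪ʳ C (big k x) i (big-∋ k x lt)) ⟩
    W k w + card Q ≤⟨ +-monoʳ-≤ (W k w) few ⟩
    W k w + a ≡⟨ +-comm _ a ⟩
    a + W k w ∎)
    where
    open ≤-Reasoning
    Q = C ∪ big k x

  big-vs-set : ∀ k x (C : Pred n) → card C ≤ a → big k x ⊑ C ⊎ C ⊑ big k x → a ≤ card (big k x)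
      ⊎ card (C ∪ big k x) ≤ a
  big-vs-set k x C c≤a (inj₁ B⊑C) = inj₂ (≤-trans (card-mono {p = C ∪ big k x} λ i i∈ →
      merge i (∪-elim C (big k x) i∈)) c≤a)
    where
    merge : ∀ i → C ∋ i ⊎ big k x ∋ i → C ∋ i
    merge i (inj₁ h) = h
    merge i (inj₂ h) = B⊑C i h
  big-vs-set k x C c≤a (inj₂ C⊑B) with ≤-total a (card (big k x))
  ... | inj₁ le = inj₁ le
  ... | inj₂ ge = inj₂ (≤-trans (card-mono {p = C ∪ big k x} λ i i∈ → merge i (∪-elim C (big k x) i∈)) ge)
    where
    merge : ∀ i → C ∋ i ⊎ big k x ∋ i → big k x ∋ i
    merge i (inj₁ h) = C⊑B i h
    merge i (inj₂ h) = h

  -- Both are sets of largest piles: if a pile above `k` is missing from `S`, every pile of `S` is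
  -- at least as high.
  big-vs-top : ∀ k x (S : Pred n) → Top x S → big k x ⊑ S ⊎ S ⊑ big k x
  big-vs-top k x S top with 0 <? card (big k x ∖ S)
  ... | yes lt = let j , j∈ = card>0 (big k x ∖ S) lt ; j∈B , j∌S = ∖-elim (big k x) S j∈ in
    inj₂ λ i i∈ → big-∋ k x (<-≤-trans (∋-big k x j∈B) (top i j i∈ j∌S))
  ... | no ¬lt = inj₁ λ i i∈ → sub i i∈ (∋-or-∌ S i)
    where
    sub : ∀ i → big k x ∋ i → S ∋ i ⊎ S ∌ i → S ∋ i
    sub i i∈ (inj₁ h) = h
    sub i i∈ (inj₂ h) = ⊥-elim (¬lt (card-∋ (big k x ∖ S) (∖-intro (big k x) S i∈ h)))

  tetrisF⁻ : ∀ f x {t} → t ≤ tetrisF H f x → Feasible t x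
  tetrisF⁻ f x {zero} _ rewrite *-zeroʳ a = z≤n
  tetrisF⁻ (suc f) x {suc t} le with A , A∈ , lt ← foldr-⊔⁻ (λ A → if allPos A x then suc
      (tetrisF H f (dec1 A x)) else 0) (edges H) le
    with allPos A x in pos | lt
  ... | true | s≤s le′ = begin
    a * suc t ≡⟨ *-suc a t ⟩
    a + a * t ≡⟨ +-comm a _ ⟩
    a * t + a ≤⟨ +-mono-≤ (tetrisF⁻ f w le′) (min-a (lookup A) (trans (cong H (tabulate∘lookup A))
        (∈-edges⁻ H A∈))) ⟩
    W t w + card (lookup A) ≤⟨ W-move t x w (lookup A) (λ i → subst (_≤ lookup x i)
        (sym (lookup-dec1 A x i)) (m∸n≤m _ ⟦ lookup A i ⟧)) dec ⟩
    W (suc t) x ∎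
    where
    open ≤-Reasoning
    w = dec1 A x
    dec : ∀ i → lookup A ∋ i → lookup w i < lookup x i
    dec i i∈ rewrite lookup-dec1 A x i | i∈ with lookup x i | allPos⁻ A x pos i i∈
    ... | suc v | _ = ≤-refl

  -- Greedy play: one stone is taken from each of the `a` largest piles, and `feasible-lower`
  -- preserves the criterion.
  tetrisF⁺ : ∀ f x {t} → t ≤ f → Feasible t x → t ≤ tetrisF H f x
  tetrisF⁺ f x {zero} _ _ = z≤n
  tetrisF⁺ (suc f) x {suc t} (s≤s t≤f) fe
    with S , _ , top , c ← extend x ∅ (Top-∅ x) a (subst (_≤ a) (sym (card-∅ n)) z≤n)
           (≤-trans (feasible-sparse x fe (positive x)
               (λ i i∌ → n≤0⇒n≡0 (≮⇒≥ (∌⇒¬∋ (positive x) i∌ ∘ positive-∋ x)))) (card-≤n (positive x))) =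
    ≤-trans le (foldr-⊔⁺ (λ A → if allPos A x then suc (tetrisF H f (dec1 A x)) else 0) (edges H)
        (∈-edges⁺ H (edge-a S c)))
    where
    A = tabulate S
    pos : ∀ i → lookup A ∋ i → 0 < lookup x i
    -- If a chosen pile were empty, so would be every pile outside `S`; fewer than `a` nonempty
    -- piles would remain, against `feasible-sparse`.
    pos i i∈A = ≮⇒≥ λ { (s≤s x≤0) → <-irrefl refl (≤-<-trans
        (feasible-sparse x fe (S ∖ single i) λ j j∌ → zeros j j∌ (n≤0⇒n≡0 x≤0) (∋-or-∌ S j))
        (<-≤-trans (card-strict {p = S ∖ single i} {S} (λ j → proj₁ ∘ ∖-elim S (single i))
            {i} (¬∋⇒∌ (S ∖ single i) λ e → ∌⇒¬∋ (single i) (proj₂ (∖-elim S (single i) e))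
                (∋-single i)) i∈) (≤-reflexive c))) }
      where
      i∈ : S ∋ i
      i∈ = trans (sym (lookup∘tabulate S i)) i∈A
      zeros : ∀ j → S ∖ single i ∌ j → lookup x i ≡ 0 → S ∋ j ⊎ S ∌ j → lookup x j ≡ 0
      zeros j j∌ xi≡0 (inj₂ j∌S) = n≤0⇒n≡0 (subst (lookup x j ≤_) xi≡0 (top i j i∈ j∌S))
      zeros j j∌ xi≡0 (inj₁ j∈S) with ∋-or-∌ (single i) j
      ... | inj₁ s = trans (cong (lookup x) (sym (single-≡ {i = i} s))) xi≡0
      ... | inj₂ s = ⊥-elim (∌⇒¬∋ (S ∖ single i) j∌ (∖-intro S (single i) j∈S s))
    fe′ : Feasible t (dec1 A x)
    fe′ = feasible-lower x (dec1 A x) S fe (λ i → subst (λ v → lookup x i ≤ v + ⟦ S i ⟧)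
        (sym (trans (lookup-dec1 A x i) (cong (λ b → lookup x i ∸ ⟦ b ⟧) (lookup∘tabulate S i))))
      (subst (lookup x i ≤_) (+-comm ⟦ S i ⟧ _) (m≤n+m∸n (lookup x i) ⟦ S i ⟧)))
      (big-vs-set t x S (≤-reflexive c) (big-vs-top t x S top))
    le : suc t ≤ (if allPos A x then suc (tetrisF H f (dec1 A x)) else 0)
    le rewrite allPos⁺ A x pos = s≤s (tetrisF⁺ f (dec1 A x) t≤f fe′)

  τ : Position n → ℕ
  τ = tetris H

  τ⇒feasible : ∀ x {t} → t ≤ τ x → Feasible t x
  τ⇒feasible x = tetrisF⁻ (suc (sumV x)) x

  feasible⇒τ : ∀ x {t} → Feasible t x → t ≤ τ x
  -- The fuel suffices, since `t ≤ a * t ≤ W t x ≤ sumV x`.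
  feasible⇒τ x {t} fe = tetrisF⁺ (suc (sumV x)) x (m≤n⇒m≤1+n (begin
    t ≤⟨ m≤n*m t a {{>-nonZero 0<a}} ⟩
    a * t ≤⟨ fe ⟩
    W t x ≤⟨ sum-mono (λ i → m⊓n≤m (lookup x i) t) ⟩
    sum (lookup x) ≡⟨ sumV-sum x ⟨
    sumV x ∎)) fe
    where open ≤-Reasoning

  τ-mono : ∀ x w → (∀ i → lookup x i ≤ lookup w i) → τ x ≤ τ w
  τ-mono x w le = feasible⇒τ w (≤-trans (τ⇒feasible x ≤-refl) (W-mono (τ x) {x} {w} le))

  τ-lower : ∀ {k} x w (C : Pred n) → k < τ x → (∀ i → lookup x i ≤ lookup w i + ⟦ C i ⟧) →
    a ≤ card (big k x) ⊎ card (C ∪ big k x) ≤ a → k ≤ τ w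
  τ-lower x w C lt le alt = feasible⇒τ w (feasible-lower x w C (τ⇒feasible x lt) le alt)

  τ-dense : ∀ {k} x (p : Pred n) → a ≤ card p → (∀ i → p ∋ i → k ≤ lookup x i) → k ≤ τ x
  τ-dense {k} x p a≤p le = feasible⇒τ x (≤-trans (*-monoˡ-≤ k a≤p) (W-dense k x p le))

  τ-sparse : ∀ {k} x (p : Pred n) → (∀ i → p ∌ i → lookup x i ≡ 0) → k < τ x → a ≤ card p
  τ-sparse x p z lt = feasible-sparse x (τ⇒feasible x lt) p z

  -- With at most `a` piles available, each move must use all of them, including the low pile `i`.
  τ-sparse-≤ : ∀ {k} x (p : Pred n) → (∀ i → p ∌ i → lookup x i ≡ 0) → card p ≤ a → ∀ {i} → p ∋ i →
      lookup x i ≤ k → τ x ≤ k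
  τ-sparse-≤ {k} x p z p≤a i∈ le = ≮⇒≥ λ lt → <⇒≱ (W-sparse-strict (suc k) x p z i∈ (s≤s le))
      (≤-trans (*-monoˡ-≤ (suc k) p≤a) (τ⇒feasible x lt))

  -- A move, however many stones it takes, lowers at least `a` piles, which is the supply for one
  -- further unit move from `x`.
  τ-move : ∀ x w → Move H x w → τ w < τ x
  τ-move x w (le , e) = feasible⇒τ x (begin
    a * suc (τ w) ≡⟨ *-suc a (τ w) ⟩
    a + a * τ w ≡⟨ +-comm a _ ⟩
    a * τ w + a ≤⟨ +-mono-≤ (τ⇒feasible w ≤-refl) (min-a (supp x w) e) ⟩
    W (τ w) w + card (supp x w) ≤⟨ W-move (τ w) x w (supp x w) le (λ i → ∋-supp x w) ⟩
    W (suc (τ w)) x ∎)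
    where open ≤-Reasoning

-- Reaching a prescribed Tetris value

minV-≤ : ∀ {n} (x : Position n) i → minV x ≤ lookup x i
minV-≤ (x ∷ []) zero = ≤-refl
minV-≤ (x ∷ y ∷ ys) zero = m⊓n≤m x _
minV-≤ (x ∷ y ∷ ys) (suc i) = ≤-trans (m⊓n≤n x _) (minV-≤ (y ∷ ys) i)

minV-attained : ∀ {n} (x : Position (suc n)) → ∃ λ i → lookup x i ≡ minV x
minV-attained (x ∷ []) = zero , refl
minV-attained (x ∷ y ∷ ys) with ⊓-sel x (minV (y ∷ ys))
... | inj₁ e = zero , sym e
... | inj₂ e = let i , e′ = minV-attained (y ∷ ys) in suc i , trans e′ (sym e)

minV-unique : ∀ {n} (x : Position n) {m} i → lookup x i ≡ m → (∀ j → m ≤ lookup x j) → minV x ≡ m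
minV-unique {suc n} x i e h = ≤-antisym (≤-trans (minV-≤ x i) (≤-reflexive e)) (let j , e′ = minV-attained x in ≤-trans (h j) (≤-reflexive e′))

lookup-shift : ∀ {n} m (x : Position n) i → lookup (shift m x) i ≡ lookup x i ∸ m
lookup-shift m (x ∷ xs) zero = refl
lookup-shift m (x ∷ xs) (suc i) = lookup-shift m xs i

zeroOn : ∀ {n} → Pred n → Position n → Position n
zeroOn S x = tabulate λ i → if S i then 0 else lookup x i

zeroOn-∋ : ∀ {n} (S : Pred n) x {i} → S ∋ i → lookup (zeroOn S x) i ≡ 0
zeroOn-∋ S x {i} e = trans (lookup∘tabulate _ i) (cong (λ b → if b then 0 else lookup x i) e)

zeroOn-∌ : ∀ {n} (S : Pred n) x {i} → S ∌ i → lookup (zeroOn S x) i ≡ lookup x i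
zeroOn-∌ S x {i} e = trans (lookup∘tabulate _ i) (cong (λ b → if b then 0 else lookup x i) e)

zeroOn-≤ : ∀ {n} (S : Pred n) x i → lookup (zeroOn S x) i ≤ lookup x i
zeroOn-≤ S x i with ∋-or-∌ S i
... | inj₁ e = subst (_≤ lookup x i) (sym (zeroOn-∋ S x e)) z≤n
... | inj₂ e = ≤-reflexive (zeroOn-∌ S x e)

lower : ∀ {n} → Pred n → Position n → Position n
lower C x = tabulate λ i → lookup x i ∸ ⟦ C i ⟧

lookup-lower : ∀ {n} (C : Pred n) x i → lookup (lower C x) i ≡ lookup x i ∸ ⟦ C i ⟧
lookup-lower C x i = lookup∘tabulate _ i

lower-∋ : ∀ {n} (C : Pred n) x {i} → C ∋ i → 0 < lookup x i → lookup (lower C x) i < lookup x i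
lower-∋ C x {i} e lt rewrite lookup-lower C x i | e with lookup x i
lower-∋ C x {i} e () | zero
... | suc v = ≤-refl

lower-∌ : ∀ {n} (C : Pred n) x {i} → C ∌ i → lookup (lower C x) i ≡ lookup x i
lower-∌ C x {i} e = trans (lookup-lower C x i) (cong (λ b → lookup x i ∸ ⟦ b ⟧) e)

lower-≤ : ∀ {n} (C : Pred n) x i → lookup (lower C x) i ≤ lookup x i
lower-≤ C x i = subst (_≤ lookup x i) (sym (lookup-lower C x i)) (m∸n≤m _ ⟦ C i ⟧)

≤-lower : ∀ {n} (C : Pred n) x i → lookup x i ≤ lookup (lower C x) i + ⟦ C i ⟧
≤-lower C x i = subst (λ v → lookup x i ≤ v + ⟦ C i ⟧) (sym (lookup-lower C x i))
    (subst (lookup x i ≤_) (+-comm ⟦ C i ⟧ _) (m≤n+m∸n (lookup x i) ⟦ C i ⟧))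

supp-≡ : ∀ {n} (x w : Position n) (S : Pred n) → (∀ i → S ∋ i → lookup w i < lookup x i) →
    (∀ i → S ∌ i → lookup x i ≤ lookup w i) →
  ∀ i → supp x w i ≡ S i
supp-≡ x w S lt ge i with ∋-or-∌ S i
... | inj₁ e = trans (supp-∋ x w (lt i e)) (sym e)
... | inj₂ e = trans (¬∋⇒∌ (supp x w) (≤⇒≯ (ge i e) ∘ ∋-supp x w)) (sym e)

card-insert-≤ : ∀ {n} (i : Fin n) p → card (insert i p) ≤ suc (card p)
card-insert-≤ i p with ∋-or-∌ p i
... | inj₂ e = ≤-reflexive (card-insert i p e)
... | inj₁ e = m≤n⇒m≤1+n (card-mono {p = insert i p} λ j j∈ → sub j (∪-elim p (single i) j∈))
  where
  sub : ∀ j → p ∋ j ⊎ single i ∋ j → p ∋ j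
  sub j (inj₁ h) = h
  sub j (inj₂ h) = trans (cong p (sym (single-≡ {i = i} h))) e

module Sufficiency {n : ℕ} (H : Hypergraph n) (a : ℕ) (0<a : 0 < a)
  (edge-a : ∀ p → card p ≡ a → H (tabulate p) ≡ true)
  (min-a : ∀ p → H (tabulate p) ≡ true → a ≤ card p)
  (2a≤n : a + a ≤ n) (3≤n : 3 ≤ n)
  (window : ∀ s → s + a < n → ∃ λ d → s < d × d ≤ s + a × (∀ p → card p ≡ d → H (tabulate p) ≡ true))
  where

  open Tetris H a 0<a edge-a min-a

  a≤n : a ≤ n
  a≤n = ≤-trans (m≤m+n a a) 2a≤n

  -- One arbitrary pile may be added to fewer than `a` largest ones. This lets a smallest pile be
  -- lowered too without `τ` dropping by more than one.
  near-top : ∀ k x (S : Pred n) i → Top x S → card S < a → a ≤ card (big k x) ⊎ card (insert i S ∪ big k x) ≤ a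
  near-top k x S i top lt with <-≤-connex (card (big k x)) a | big-vs-top k x S top
  ... | inj₂ ge | _ = inj₁ ge
  ... | inj₁ _ | inj₁ B⊑S = big-vs-set k x (insert i S) (≤-trans (card-insert-≤ i S) lt)
      (inj₁ λ j → ∋-∪ˡ S (single i) j ∘ B⊑S j)
  ... | inj₁ few | inj₂ S⊑B = inj₂ (≤-trans (card-mono {p = insert i S ∪ big k x} {insert i (big k x)}
      λ j j∈ → sub j (∪-elim (insert i S) (big k x) j∈))
         (≤-trans (card-insert-≤ i (big k x)) few))
    where
    sub : ∀ j → insert i S ∋ j ⊎ big k x ∋ j → insert i (big k x) ∋ j
    sub j (inj₂ h) = ∋-∪ˡ (big k x) (single i) j h
    sub j (inj₁ h) with ∪-elim S (single i) h
    ... | inj₁ h′ = ∋-∪ˡ (big k x) (single i) j (S⊑B j h′)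
    ... | inj₂ h′ = ∋-∪ʳ (big k x) (single i) j h′

  τ-lower-single : ∀ {k} x i → k < τ x → k ≤ τ (lower (single i) x)
  τ-lower-single {k} x i lt = τ-lower x (lower (single i) x) (insert i ∅) lt (≤-lower (single i) x)
    (near-top k x ∅ i (Top-∅ x) (subst (_< a) (sym (card-∅ n)) 0<a))

  -- A discrete intermediate value argument: stones are taken from `v` one at a time towards `u`,
  -- and by `τ-lower-single` no value of `τ` is skipped.
  intermediate : ∀ u v l → (∀ i → lookup u i ≤ lookup v i) → τ u ≤ l → l ≤ τ v →
    ∃ λ w → (∀ i → lookup u i ≤ lookup w i) × (∀ i → lookup w i ≤ lookup v i) × τ w ≡ l
  intermediate u v l u≤v lo hi = go v u≤v hi (<-wellFounded _)
    where
    go : ∀ v → (∀ i → lookup u i ≤ lookup v i) → l ≤ τ v → Acc _<_ (sum (lookup v)) →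
      ∃ λ w → (∀ i → lookup u i ≤ lookup w i) × (∀ i → lookup w i ≤ lookup v i) × τ w ≡ l
    go v u≤v hi (acc rs) with m≤n⇒m<n∨m≡n hi | 0 <? card (supp v u)
    ... | inj₂ e | _ = v , u≤v , (λ _ → ≤-refl) , sym e
    ... | inj₁ lt | no none =
        ⊥-elim (<⇒≱ lt (≤-trans (τ-mono v u λ i → ∌-supp v u (¬∋⇒∌ (supp v u) (none ∘ card-∋ (supp v u)))) lo))
    ... | inj₁ lt | yes some with i , i∈ ← card>0 (supp v u) some =
      let w , u≤w , w≤v′ , e = go v′ u≤v′ (τ-lower-single v i lt) (rs (sum-strict (lower-≤ (single i) v) i dec))
      in w , u≤w , (λ j → ≤-trans (w≤v′ j) (lower-≤ (single i) v j)) , e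
      where
      v′ = lower (single i) v
      dec : lookup v′ i < lookup v i
      dec = lower-∋ (single i) v (∋-single i) (≤-<-trans z≤n (∋-supp v u i∈))
      u≤v′ : ∀ j → lookup u j ≤ lookup v′ j
      u≤v′ j with ∋-or-∌ (single i) j
      ... | inj₂ e = subst (lookup u j ≤_) (sym (lower-∌ (single i) v e)) (u≤v j)
      ... | inj₁ e with refl ← single-≡ {i = i} e = ≤-pred (≤-trans (∋-supp v u i∈)
          (subst (lookup v i ≤_) (trans (cong (λ b → lookup v′ i + ⟦ b ⟧) e) (+-comm _ 1))
              (≤-lower (single i) v i)))

  -- Emptying the top piles one by one lowers τ to at most l; just before that happens,
  -- the top set can be enlarged to a hyperedge by at most a further piles.
  descend : ∀ x l S → Top x S → card S + a ≤ n → l < τ (zeroOn S x) → (∃ λ i → lookup x i ≤ l) →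
    ∃ λ w → Move H x w × τ w ≡ l × (∀ i → S ∋ i → lookup w i ≡ 0)
  descend x l S top fit high (i₀ , small) = go (n ∸ (card S + a)) S top (m∸n+n≡m fit) high
    where
    Goal : Pred n → Set
    Goal S = ∃ λ w → Move H x w × τ w ≡ l × (∀ i → S ∋ i → lookup w i ≡ 0)

    finish : ∀ S → Top x S → card S + a < n → l < τ (zeroOn S x) →
      ∀ S₁ → S ⊑ S₁ → Top x S₁ → card S₁ ≡ suc (card S) → τ (zeroOn S₁ x) ≤ l → Goal S
    finish S top fit high S₁ S⊑S₁ top₁ c₁ low
      -- The target is sought between `u`, where all of `S′` is emptied, and `v`, where `S` is
      -- emptied and each pile of `C` loses one stone. Every position between them differs from `x`
      -- exactly on `S′`, whose size `d` is an edge size; and `C` has at most `a` piles, so `τ v` is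
      -- still at least `l`.
      with d , S<d , d≤ , edge ← window (card S) fit
      with S′ , S₁⊑S′ , top′ , c ← extend x S₁ top₁ d (subst (_≤ d) (sym c₁) S<d) (≤-trans d≤ (<⇒≤ fit)) =
      let w , u≤w , w≤v , e = intermediate u v l u≤v (≤-trans (τ-mono u (zeroOn S₁ x) u≤) low)
            (τ-lower w₀ v C high (≤-lower C w₀) (big-vs-set l w₀ C C≤a (big-vs-top l w₀ C topC)))
      in w , ((λ i → ≤-trans (w≤v i) (≤-trans (lower-≤ C w₀ i) (zeroOn-≤ S x i))) ,
          edge (supp x w) (trans (card-cong (supp-≡ x w S′ (λ i i∈ → ≤-<-trans (w≤v i) (v<x i i∈))
              (λ i i∌ → subst (_≤ lookup w i) (zeroOn-∌ S′ x i∌) (u≤w i)))) c)) ,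
         e , λ i i∈ → n≤0⇒n≡0 (≤-trans (w≤v i) (≤-trans (lower-≤ C w₀ i) (≤-reflexive (zeroOn-∋ S x i∈))))
      where
      S⊑S′ : S ⊑ S′
      S⊑S′ i = S₁⊑S′ i ∘ S⊑S₁ i
      w₀ = zeroOn S x
      C = S′ ∖ S
      v = lower C w₀
      u = zeroOn S′ x
      C≤a : card C ≤ a
      C≤a = +-cancelˡ-≤ (card S) _ _ (subst (_≤ card S + a) (sym (trans (card-∖ S′ S S⊑S′) c)) d≤)
      -- Once `S` is emptied, the rest of the top set `S′` consists of largest piles.
      topC : Top w₀ C
      topC i j i∈ j∌ with ∋-or-∌ S j | ∖-elim S′ S i∈
      ... | inj₁ j∈ | _ = subst (_≤ lookup w₀ i) (sym (zeroOn-∋ S x j∈)) z≤n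
      ... | inj₂ j∌S | i∈′ , i∌ = subst₂ _≤_ (sym (zeroOn-∌ S x j∌S)) (sym (zeroOn-∌ S x i∌))
              (top′ i j i∈′ (¬∋⇒∌ S′ λ j∈′ → ∌⇒¬∋ C j∌ (∖-intro S′ S j∈′ j∌S)))
      ∌′ : ∀ {i} → S′ ∌ i → S ∌ i × C ∌ i
      ∌′ {i} i∌ = ¬∋⇒∌ S (∌⇒¬∋ S′ i∌ ∘ S⊑S′ i) , ¬∋⇒∌ C (∌⇒¬∋ S′ i∌ ∘ proj₁ ∘ ∖-elim S′ S)
      u≤v : ∀ i → lookup u i ≤ lookup v i
      u≤v i with ∋-or-∌ S′ i
      ... | inj₁ i∈ = subst (_≤ lookup v i) (sym (zeroOn-∋ S′ x i∈)) z≤n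
      ... | inj₂ i∌ = ≤-reflexive (trans (zeroOn-∌ S′ x i∌)
          (sym (trans (lower-∌ C w₀ (proj₂ (∌′ i∌))) (zeroOn-∌ S x (proj₁ (∌′ i∌))))))
      u≤ : ∀ i → lookup u i ≤ lookup (zeroOn S₁ x) i
      u≤ i with ∋-or-∌ S′ i
      ... | inj₁ i∈ = subst (_≤ lookup (zeroOn S₁ x) i) (sym (zeroOn-∋ S′ x i∈)) z≤n
      ... | inj₂ i∌ = ≤-reflexive (trans (zeroOn-∌ S′ x i∌)
          (sym (zeroOn-∌ S₁ x (¬∋⇒∌ S₁ (∌⇒¬∋ S′ i∌ ∘ S₁⊑S′ i)))))
      -- An empty pile in `S` would make `w₀` zero; an empty pile in `C` would leave fewer than `a`
      -- nonempty piles in `w₀`. Either contradicts `high`.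
      pos : ∀ i → S′ ∋ i → 0 < lookup x i
      pos i i∈ with 0 <? lookup x i | ∋-or-∌ S i
      ... | yes lt | _ = lt
      ... | no ¬lt | inj₁ i∈S = ⊥-elim (<⇒≱ (subst (_< a) (sym (card-∅ n)) 0<a) (τ-sparse w₀ ∅ zeros high))
        where
        zeros : ∀ j → ∅ {n} ∌ j → lookup w₀ j ≡ 0
        zeros j _ with ∋-or-∌ S j
        ... | inj₁ j∈ = zeroOn-∋ S x j∈
        ... | inj₂ j∌ = trans (zeroOn-∌ S x j∌) (n≤0⇒n≡0 (≤-trans (top i j i∈S j∌) (≮⇒≥ ¬lt)))
      ... | no ¬lt | inj₂ i∌S =
          ⊥-elim (<⇒≱ (<-≤-trans (card-strict {p = C ∖ single i} {C} (λ j → proj₁ ∘ ∖-elim C (single i)) {i}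
                (¬∋⇒∌ (C ∖ single i) λ e → ∌⇒¬∋ (single i) (proj₂ (∖-elim C (single i) e))
                    (∋-single i)) (∖-intro S′ S i∈ i∌S)) C≤a)
              (τ-sparse w₀ (C ∖ single i) zeros high))
        where
        zeros : ∀ j → C ∖ single i ∌ j → lookup w₀ j ≡ 0
        zeros j j∌ with ∋-or-∌ (single i) j | ∋-or-∌ S j | ∋-or-∌ S′ j
        ... | _ | inj₁ j∈ | _ = zeroOn-∋ S x j∈
        ... | _ | inj₂ j∌S | inj₂ j∌′ = trans (zeroOn-∌ S x j∌S) (n≤0⇒n≡0 (≤-trans (top′ i j i∈ j∌′) (≮⇒≥ ¬lt)))
        ... | inj₁ s | inj₂ j∌S | inj₁ _ = trans (zeroOn-∌ S x j∌S)
            (n≤0⇒n≡0 (subst (λ j → lookup x j ≤ 0) (single-≡ {i = i} s) (≮⇒≥ ¬lt)))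
        ... | inj₂ s | inj₂ j∌S | inj₁ j∈′ = ⊥-elim (∌⇒¬∋ (C ∖ single i) j∌ (∖-intro C (single i)
            (∖-intro S′ S j∈′ j∌S) s))
      v<x : ∀ i → S′ ∋ i → lookup v i < lookup x i
      v<x i i∈ with ∋-or-∌ S i
      ... | inj₁ i∈S = ≤-<-trans (lower-≤ C w₀ i) (subst (_< lookup x i) (sym (zeroOn-∋ S x i∈S)) (pos i i∈))
      ... | inj₂ i∌S = <-≤-trans (lower-∋ C w₀ (∖-intro S′ S i∈ i∌S)
          (subst (0 <_) (sym (zeroOn-∌ S x i∌S)) (pos i i∈))) (zeroOn-≤ S x i)

    go : ∀ r S → Top x S → r + (card S + a) ≡ n → l < τ (zeroOn S x) → Goal S
    -- Exactly `a` piles remain, one of them at most `l`; each move needs them all, so `τ` cannot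
    -- exceed `l`.
    go zero S top eq high = ⊥-elim (<⇒≱ high (τ-sparse-≤ (zeroOn S x) (∁ S)
        (λ i i∌ → zeroOn-∋ S x (uncompl i∌)) (≤-reflexive c) (∁-intro S j∌) (≤-trans (zeroOn-≤ S x j) j≤)))
      where
      c : card (∁ S) ≡ a
      c = +-cancelˡ-≡ (card S) _ _ (trans (card-∁ S) (sym eq))
      uncompl : ∀ {i} → ∁ S ∌ i → S ∋ i
      uncompl {i} e with S i
      ... | true = refl
      smallest : ∃ λ j → S ∌ j × lookup x j ≤ l
      smallest with ∋-or-∌ S i₀
      ... | inj₂ e = i₀ , e , small
      ... | inj₁ e = let j , j∌ = card-gap S (subst (card S <_) eq (m<m+n (card S) 0<a)) in j ,
                           j∌ , ≤-trans (top i₀ j e j∌) small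
      j = proj₁ smallest
      j∌ = proj₁ (proj₂ smallest)
      j≤ = proj₂ (proj₂ smallest)
    go (suc r) S top eq high
      with i , i∌ , top₁ ← grow x S top (≤-trans (s≤s (≤-trans (m≤m+n (card S) a) (m≤n+m _ r)))
          (≤-reflexive eq))
      with <-≤-connex l (τ (zeroOn (insert i S) x))
    ... | inj₂ low = finish S top (subst (card S + a <_) eq (s≤s (m≤n+m _ r))) high (insert i S)
        (∋-∪ˡ S (single i)) top₁ (card-insert i S i∌) low
    ... | inj₁ high₁ = let w , mv , e , z = go r (insert i S)
                             top₁ (trans (cong (λ c → r + (c + a)) (card-insert i S i∌))
                                 (trans (+-suc r _) eq)) high₁
                       in w , mv , e , λ j → z j ∘ ∋-∪ˡ S (single i) j

  -- n₀ is a largest pile, i₀ a smallest one, and A consists of i₀ and a − 1 largest piles.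
  record Frame (x : Position n) : Set where
    field
      n₀ i₀ : Fin n
      A : Pred n
      i₀∈A : A ∋ i₀
      smallest : ∀ j → lookup x i₀ ≤ lookup x j
      largest : Top x (single n₀)
      near : ∀ k → a ≤ card (big k x) ⊎ card (A ∪ big k x) ≤ a
      edge : ∀ Q → A ⊑ Q → Q ⊑ insert n₀ A → H (tabulate Q) ≡ true

  card-squeeze : ∀ {p q : Pred n} → p ⊑ q → q ⊑ p → card p ≡ card q
  card-squeeze {p} {q} h h′ = ≤-antisym (card-mono {p = p} h) (card-mono {p = q} h′)

  -- `i₀` is chosen lowest outside the top set `M`, hence is lowest overall. As it is only found
  -- here, the assumption on edges ranges over every `i₀` outside `M`.
  frame-around : ∀ x (n₀ : Fin n) (R M : Pred n) → Top x (single n₀) → Top x R → suc (card R) ≡ a →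
      Top x M → card M < n → R ⊑ M →
    (∀ i₀ → M ∌ i₀ → ∀ Q → insert i₀ R ⊑ Q → Q ⊑ insert n₀ (insert i₀ R) → H (tabulate Q) ≡ true) → Frame x
  frame-around x n₀ R M topn topR cR topM cM R⊑M edge
    with i₀ , i∈ , min ← argmin (lookup x) (∁ M) (let i , i∌ = card-gap M cM in i , ∁-intro M i∌) = record
    { n₀ = n₀ ; i₀ = i₀ ; A = insert i₀ R ; i₀∈A = ∋-insert i₀ R
    ; smallest = smallest
    ; largest = topn
    ; near = λ k → near-top k x R i₀ topR (≤-reflexive cR)
    ; edge = edge i₀ i₀∌
    }
    where
    i₀∌ : M ∌ i₀
    i₀∌ = ∁-elim M i∈
    smallest : ∀ j → lookup x i₀ ≤ lookup x j
    smallest j with ∋-or-∌ M j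
    ... | inj₁ j∈ = topM j i₀ j∈ i₀∌
    ... | inj₂ j∌ = min j (∁-intro M j∌)

  -- For `a > 1` the pile `n₀` is among the `a - 1` largest, so adding it to `A` changes nothing.
  -- For `a = 1` the set `A` is `i₀` alone, distinct from `n₀`, and adding `n₀` requires the 2-sets
  -- to be edges.
  frame : ∀ x → Frame x
  frame x with n₀ , _ , topn ← grow x ∅ (Top-∅ x) (subst (_< n) (sym (card-∅ n))
      (≤-trans (s≤s z≤n) 3≤n)) with m≤n⇒m<n∨m≡n 0<a
  ... | inj₁ 1<a with R , n₀∈ , topR , cR ← extend x (single n₀) topn (pred a)
      (subst (_≤ pred a) (sym (card-single n₀)) (pred-mono-≤ 1<a)) (≤-trans pred[n]≤n a≤n) =
    frame-around x n₀ R R topn topR c topR (subst (_≤ n) (sym c) a≤n) (λ _ → id) λ i₀ i₀∌ Q lo hi →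
      edge-a Q (trans (sym (card-squeeze {insert i₀ R} {Q} lo λ j j∈ → absorb i₀ j
          (∪-elim (insert i₀ R) (single n₀) (hi j j∈)))) (trans (card-insert i₀ R i₀∌) c))
    where
    c : suc (card R) ≡ a
    c = trans (cong suc cR) (suc-pred a {{>-nonZero 0<a}})
    absorb : ∀ i₀ j → insert i₀ R ∋ j ⊎ single n₀ ∋ j → insert i₀ R ∋ j
    absorb i₀ j (inj₁ h) = h
    absorb i₀ j (inj₂ h) = ∋-∪ˡ R (single i₀) j (n₀∈ j h)
  frame x | inj₂ 1≡a = frame-around x n₀ ∅ (single n₀) topn (Top-∅ x) (trans (cong suc (card-∅ n)) 1≡a) topn
      (subst (_< n) (sym (card-single n₀)) (≤-trans (s≤s (s≤s z≤n)) 3≤n)) (λ _ ()) edge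
    where
    edge-2 : ∀ p → card p ≡ 2 → H (tabulate p) ≡ true
    -- With `a = 1` the window above 1 contains only the size 2, and `3 ≤ n` makes it available.
    edge-2 p c with d , lo , hi , h ← window 1 (subst (λ a → suc a < n) 1≡a 3≤n) =
      h p (trans c (≤-antisym lo (subst (λ a → d ≤ suc a) (sym 1≡a) hi)))
    edge : ∀ i₀ → single n₀ ∌ i₀ → ∀ Q → single i₀ ⊑ Q → Q ⊑ insert n₀ (single i₀) → H (tabulate Q) ≡ true
    edge i₀ i₀∌ Q lo hi with ∋-or-∌ Q n₀
    ... | inj₁ n₀∈ = edge-2 Q (trans (card-squeeze {Q} {insert n₀ (single i₀)} hi λ j j∈ →
        sub j (∪-elim (single i₀) (single n₀) j∈))
            (trans (card-insert n₀ (single i₀) (¬∋⇒∌ (single i₀) λ e → ∌⇒¬∋ (single n₀)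
                i₀∌ (subst (λ i → single n₀ ∋ i) (sym (single-≡ {i = i₀} e)) (∋-single n₀))))
                    (cong suc (card-single i₀))))
      where
      sub : ∀ j → single i₀ ∋ j ⊎ single n₀ ∋ j → Q ∋ j
      sub j (inj₁ h) = lo j h
      sub j (inj₂ h) = subst (Q ∋_) (single-≡ {i = n₀} h) n₀∈
    ... | inj₂ n₀∌ = edge-a Q
        (trans (card-squeeze {Q} {single i₀} (λ j j∈ → sub j j∈ (∪-elim (single i₀) (single n₀)
            (hi j j∈))) lo) (trans (card-single i₀) 1≡a))
      where
      sub : ∀ j → Q ∋ j → single i₀ ∋ j ⊎ single n₀ ∋ j → single i₀ ∋ j
      sub j j∈ (inj₁ h) = h
      sub j j∈ (inj₂ h) = ⊥-elim (∌⇒¬∋ Q n₀∌ (subst (Q ∋_) (sym (single-≡ {i = n₀} h)) j∈))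

  -- A dividing position: values of `τ` from the minimum up to that of the corner are realised with
  -- an empty pile, larger ones between the corner and `lower A x`.
  corner : ∀ x → Frame x → Position n
  corner x F = zeroOn (single i₀) (lower A x)
    where open Frame F

  module _ (x : Position n) (F : Frame x) (pos : 0 < minV x) where
    open Frame F
    private
      x₁ x₀ : Position n
      x₁ = lower A x
      x₀ = corner x F

    x>0 : ∀ i → 0 < lookup x i
    x>0 i = <-≤-trans pos (minV-≤ x i)

    ≤minV : lookup x i₀ ≤ minV x
    ≤minV = ≤-reflexive (sym (minV-unique x i₀ refl smallest))

    corner-away : ∀ {i} → A ∌ i → lookup x₀ i ≡ lookup x i
    corner-away {i} i∌ = trans (zeroOn-∌ (single i₀) x₁ (¬∋⇒∌ (single i₀) λ e → ∌⇒¬∋ A i∌ (subst (A ∋_)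
        (single-≡ {i = i₀} e) i₀∈A))) (lower-∌ A x i∌)

    ≤-corner : ∀ i → i ≢ i₀ → lookup x i ≤ suc (lookup x₀ i)
    ≤-corner i ne = subst (λ v → lookup x i ≤ suc v)
        (sym (zeroOn-∌ (single i₀) x₁ (¬∋⇒∌ (single i₀) λ e → ne (sym (single-≡ {i = i₀} e)))))
      (≤-trans (≤-lower A x i) (≤-trans (+-monoʳ-≤ (lookup x₁ i) (⟦⟧-mono (A i) true λ _ → refl))
          (≤-reflexive (+-comm _ 1))))

    corner-0 : lookup x₀ i₀ ≡ 0
    corner-0 = zeroOn-∋ (single i₀) x₁ (∋-single i₀)

    -- If emptying `n₀` leaves `τ` above `l`, `descend` starts from `n₀`, which stays empty.
    -- Otherwise `w` lies between the corner and the corner with `n₀` emptied: its support is `A`,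
    -- possibly with `n₀` added, and pile `i₀` is empty.
    reach-below-corner : ∀ l → minV x ≤ l → l ≤ τ x₀ → ∃ λ w → Move H x w × τ w ≡ l × ∃ λ i → lookup w i ≡ 0
    reach-below-corner l m≤l hi with <-≤-connex l (τ (zeroOn (single n₀) x))
    ... | inj₁ high = let w , mv , e , z = descend x l (single n₀) largest (subst (λ c → c + a ≤ n)
                            (sym (card-single n₀)) (≤-trans (+-monoˡ-≤ a 0<a) 2a≤n))
                                high (i₀ , ≤-trans ≤minV m≤l)
                      in w , mv , e , n₀ , z n₀ (∋-single n₀)
    ... | inj₂ low = let w , u≤w , w≤v , e = intermediate u x₀ l (zeroOn-≤ (single n₀) x₀)
                           (≤-trans (τ-mono u (zeroOn (single n₀) x) u≤) low) hi
                     in w , ((λ i → ≤-trans (w≤v i) (x₀≤ i)) , edge (supp x w)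
                         (λ i i∈ → supp-∋ x w (≤-<-trans (w≤v i) (x₀< i i∈)))
                             (λ i i∈ → outside w u≤w i (∋-supp x w i∈))) , e , i₀ ,
                                 n≤0⇒n≡0 (≤-trans (w≤v i₀) (≤-reflexive corner-0))
      where
      u = zeroOn (single n₀) x₀
      x₀≤ : ∀ i → lookup x₀ i ≤ lookup x i
      x₀≤ i = ≤-trans (zeroOn-≤ (single i₀) x₁ i) (lower-≤ A x i)
      x₀< : ∀ i → A ∋ i → lookup x₀ i < lookup x i
      x₀< i i∈ = ≤-<-trans (zeroOn-≤ (single i₀) x₁ i) (lower-∋ A x i∈ (x>0 i))
      u≤ : ∀ i → lookup u i ≤ lookup (zeroOn (single n₀) x) i
      u≤ i with ∋-or-∌ (single n₀) i
      ... | inj₁ e = subst (_≤ lookup (zeroOn (single n₀) x) i) (sym (zeroOn-∋ (single n₀) x₀ e)) z≤n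
      ... | inj₂ e = subst₂ _≤_ (sym (zeroOn-∌ (single n₀) x₀ e)) (sym (zeroOn-∌ (single n₀) x e)) (x₀≤ i)
      outside : ∀ w → (∀ i → lookup u i ≤ lookup w i) → ∀ i → lookup w i < lookup x i → insert n₀ A ∋ i
      outside w u≤w i lt with ∋-or-∌ A i | ∋-or-∌ (single n₀) i
      ... | inj₁ h | _ = ∋-∪ˡ A (single n₀) i h
      ... | inj₂ _ | inj₁ h = ∋-∪ʳ A (single n₀) i h
      ... | inj₂ i∌ | inj₂ i≢ =
          ⊥-elim (<⇒≱ lt (subst (_≤ lookup w i) (trans (zeroOn-∌ (single n₀) x₀ i≢) (corner-away i∌)) (u≤w i)))

    -- Here the minimum is lowered at i₀ and drops at least as much as any other pile, so y does not decrease.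
    reach-above-corner : ∀ k → τ x₀ ≤ k → k < τ x →
      ∃ λ w → Move H x w × τ w ≡ k × minV w ≤ minV x × τ (shift (minV x) x) ≤ τ (shift (minV w) w)
    reach-above-corner k lo hi =
      let w , x₀≤w , w≤x₁ , e = intermediate x₀ x₁ k (zeroOn-≤ (single i₀) x₁)
            lo (τ-lower x x₁ A hi (≤-lower A x) (near k))
      in w , ((λ i → ≤-trans (w≤x₁ i) (lower-≤ A x i)) ,
              edge (supp x w) (λ i i∈ → supp-∋ x w (≤-<-trans (w≤x₁ i) (lower-∋ A x i∈ (x>0 i))))
                (λ i i∈ → ∋-∪ˡ A (single n₀) i (inside-A w x₀≤w i (∋-supp x w i∈)))) ,
         e , <⇒≤ (min< w w≤x₁) , τ-mono _ _ (shifts w x₀≤w w≤x₁)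
      where
      inside-A : ∀ w → (∀ i → lookup x₀ i ≤ lookup w i) → ∀ i → lookup w i < lookup x i → A ∋ i
      inside-A w x₀≤w i lt with ∋-or-∌ A i
      ... | inj₁ h = h
      ... | inj₂ h = ⊥-elim (<⇒≱ lt (subst (_≤ lookup w i) (corner-away h) (x₀≤w i)))
      min< : ∀ w → (∀ i → lookup w i ≤ lookup x₁ i) → minV w < minV x
      min< w w≤x₁ = ≤-<-trans (≤-trans (minV-≤ w i₀) (w≤x₁ i₀)) (<-≤-trans (lower-∋ A x i₀∈A (x>0 i₀)) ≤minV)
      shifts : ∀ w → (∀ i → lookup x₀ i ≤ lookup w i) → (∀ i → lookup w i ≤ lookup x₁ i) → ∀ i →
          lookup (shift (minV x) x) i ≤ lookup (shift (minV w) w) i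
      shifts w x₀≤w w≤x₁ i = subst₂ _≤_ (sym (lookup-shift _ x i)) (sym (lookup-shift _ w i)) (aux (i Fin.≟ i₀))
        where
        aux : Dec (i ≡ i₀) → lookup x i ∸ minV x ≤ lookup w i ∸ minV w
        aux (yes refl) = subst (_≤ lookup w i ∸ minV w) (sym (m≤n⇒m∸n≡0 ≤minV)) z≤n
        aux (no ne) = ≤-trans (∸-mono (≤-trans (≤-corner i ne) (s≤s (x₀≤w i))) (min< w w≤x₁)) ≤-refl

    -- The corner takes at most one stone from each pile other than `i₀`; the shift takes at least
    -- one from every pile and empties `i₀`.
    τ-shift≤τ-corner : τ (shift (minV x) x) ≤ τ x₀
    τ-shift≤τ-corner = τ-mono _ _ λ i → subst (_≤ lookup x₀ i) (sym (lookup-shift _ x i)) (aux i (i Fin.≟ i₀))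
      where
      aux : ∀ i → Dec (i ≡ i₀) → lookup x i ∸ minV x ≤ lookup x₀ i
      aux i (yes refl) = subst (_≤ lookup x₀ i) (sym (m≤n⇒m∸n≡0 ≤minV)) z≤n
      aux i (no ne) = ≤-trans (∸-monoʳ-≤ (lookup x i) pos) (∸-monoˡ-≤ 1 (≤-corner i ne))

  0<n : 0 < n
  0<n = ≤-trans (s≤s z≤n) 3≤n

  attained : ∀ x → ∃ λ i → lookup x i ≡ minV x
  attained = at 0<n
    where
    at : ∀ {k} → 0 < k → (x : Position k) → ∃ λ i → lookup x i ≡ minV x
    at (s≤s _) x = minV-attained x

  -- With a positive minimum the corner dominates the shifted position, so even `l` equal to its `τ`
  -- is available. With minimum zero the shifted position is `x` itself, a move must lower `τ`, and
  -- `descend` starts from the empty set while the zero pile persists.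
  reach-zero-min : ∀ x l → minV x ≤ l → l ≤ τ (shift (minV x) x) → (minV x ≡ 0 → l < τ x) →
    ∃ λ w → Move H x w × τ w ≡ l × minV w ≡ 0
  reach-zero-min x l m≤l l≤ strict with 0 <? minV x
  ... | yes pos = let w , mv , e , i , e₀ = reach-below-corner x (frame x) pos l m≤l
                        (≤-trans l≤ (τ-shift≤τ-corner x (frame x) pos))
                  in w , mv , e , minV-unique w i e₀ (λ _ → z≤n)
  ... | no ¬pos = let i , e₀ = attained x
                      w , mv , e , _ = descend x l ∅ (Top-∅ x) (subst (λ c → c + a ≤ n) (sym (card-∅ n)) a≤n)
                                         (subst (l <_) (cong τ (sym (trans (tabulate-cong λ _ → refl)
                                             (tabulate∘lookup x)))) (strict m≡0))
                                                 (i , ≤-trans (≤-reflexive e₀) m≤l)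
                  in w , mv , e , minV-unique w i
                      (n≤0⇒n≡0 (≤-trans (proj₁ mv i) (≤-reflexive (trans e₀ m≡0)))) (λ _ → z≤n)
    where
    m≡0 : minV x ≡ 0
    m≡0 = n≤0⇒n≡0 (≮⇒≥ ¬pos)

  -- Translating all piles by a constant

  raise : ℕ → Position n → Position n
  raise p x = tabulate λ i → lookup x i + p

  shift-raise : ∀ p x → shift p (raise p x) ≡ x
  shift-raise p x = trans (sym (tabulate∘lookup _))
      (trans (tabulate-cong λ i → trans (lookup-shift p (raise p x) i)
          (trans (cong (_∸ p) (lookup∘tabulate _ i)) (m+n∸n≡m _ p))) (tabulate∘lookup x))

  minV-raise : ∀ p x → minV (raise p x) ≡ minV x + p
  minV-raise p x = let i , e = attained x in
    minV-unique (raise p x) i (trans (lookup∘tabulate _ i) (cong (_+ p) e)) λ j → subst (minV x + p ≤_)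
        (sym (lookup∘tabulate _ j)) (+-monoˡ-≤ p (minV-≤ x j))

  minV-shift : ∀ p x → p ≤ minV x → minV (shift p x) ≡ minV x ∸ p
  minV-shift p x le = let i , e = attained x in
    minV-unique (shift p x) i (trans (lookup-shift p x i) (cong (_∸ p) e)) λ j → subst (minV x ∸ p ≤_)
        (sym (lookup-shift p x j)) (∸-monoˡ-≤ p (minV-≤ x j))

  shift-shift : ∀ p q (x : Position n) → shift q (shift p x) ≡ shift (p + q) x
  shift-shift p q x = trans (sym (tabulate∘lookup _))
      (trans (tabulate-cong λ i → trans (lookup-shift q (shift p x) i)
          (trans (cong (_∸ q) (lookup-shift p x i)) (trans (∸-+-assoc (lookup x i) p q)
              (sym (lookup-shift (p + q) x i))))) (tabulate∘lookup _))

  move-raise : ∀ p x w → p ≤ minV x → Move H (shift p x) w → Move H x (raise p w)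
  move-raise p x w p≤m (le , e) = (λ i → subst (lookup (raise p w) i ≤_) (eq i) (raised i (le i))) ,
      trans (cong H (tabulate-cong λ i → same i)) e
    where
    eq : ∀ i → lookup (shift p x) i + p ≡ lookup x i
    eq i = trans (cong (_+ p) (lookup-shift p x i)) (m∸n+n≡m (≤-trans p≤m (minV-≤ x i)))
    raised : ∀ i → lookup w i ≤ lookup (shift p x) i → lookup (raise p w) i ≤ lookup (shift p x) i + p
    raised i h = subst (_≤ lookup (shift p x) i + p) (sym (lookup∘tabulate _ i)) (+-monoˡ-≤ p h)
    same : ∀ i → supp x (raise p w) i ≡ supp (shift p x) w i
    same i = supp-≡ x (raise p w) (supp (shift p x) w)
      (λ i i∈ → subst₂ _<_ (sym (lookup∘tabulate _ i)) (eq i) (+-monoˡ-< p (∋-supp (shift p x) w i∈)))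
      (λ i i∌ → subst₂ _≤_ (eq i) (sym (lookup∘tabulate _ i)) (+-monoˡ-≤ p (∌-supp (shift p x) w i∌))) i

  -- Subtracting `p` from every pile reduces this to minimum zero; adding `p` back preserves moves
  -- and the shifted Tetris value.
  reach-min : ∀ x p l → p ≤ minV x → minV x ∸ p ≤ l → l ≤ τ (shift (minV x) x) →
      (minV x ≡ p → l < τ (shift (minV x) x)) →
    ∃ λ w → Move H x w × minV w ≡ p × τ (shift p w) ≡ l
  reach-min x p l p≤m j≤l l≤ strict =
    let w , mv , e , e₀ = reach-zero-min X l (subst (_≤ l) (sym mX) j≤l)
          (subst (λ y → l ≤ τ y) (sym X-shift) l≤)
                            (λ e → let m≡p = ≤-antisym (m∸n≡0⇒m≤n (trans (sym mX) e)) p≤m in subst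
                                         (λ q → l < τ (shift q x)) m≡p (strict m≡p))
    in raise p w , move-raise p x w p≤m mv , trans (minV-raise p w) (cong (_+ p) e₀) ,
        trans (cong τ (shift-raise p w)) e
    where
    X = shift p x
    mX : minV X ≡ minV x ∸ p
    mX = minV-shift p x p≤m
    X-shift : shift (minV X) X ≡ shift (minV x) x
    X-shift = trans (shift-shift p (minV X) x) (cong (λ q → shift q x) (trans (cong (p +_) mX) (m+[n∸m]≡n p≤m)))

-- The formula is a Sprague–Grundy function

open import Data.Nat.Combinatorics using (_C_; nC1≡n; nCk+nC[k+1]≡[n+1]C[k+1])

-- Arithmetic of the binomial thresholds

C2-suc : ∀ y → suc y C 2 ≡ y C 2 + y
C2-suc y = trans (sym (nCk+nC[k+1]≡[n+1]C[k+1] y 1)) (trans (cong (_+ y C 2) (nC1≡n y)) (+-comm y _))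

C2-mono : ∀ {y z} → y ≤ z → y C 2 ≤ z C 2
C2-mono {y} {z} le = subst (λ z → y C 2 ≤ z C 2) (m∸n+n≡m le) (go (z ∸ y))
  where
  go : ∀ d → y C 2 ≤ (d + y) C 2
  go zero = ≤-refl
  go (suc d) = ≤-trans (go d) (≤-trans (m≤m+n _ _) (≤-reflexive (sym (C2-suc (d + y)))))

-- Finds the binomial interval containing `k`. All values `long m l` lie in that interval, so `l` is
-- the shifted Tetris value to aim at.
C2-root : ∀ k → ∃ λ l → suc l C 2 ≤ k × k < suc (suc l) C 2
C2-root zero = 0 , z≤n , s≤s z≤n
C2-root (suc k) with l , lo , hi ← C2-root k with m≤n⇒m<n∨m≡n hi
... | inj₁ lt = l , m≤n⇒m≤1+n lo , lt
... | inj₂ eq = suc l , ≤-reflexive (sym eq) , subst₂ _<_ (sym eq) (sym (C2-suc (suc (suc l)))) (m<m+n _ z<s)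

congruent-gap : ∀ p q d .{{_ : NonZero d}} → p % d ≡ q % d → q < p → q + d ≤ p
congruent-gap p q d e lt = begin
    q + d ≡⟨ cong (_+ d) (m≡m%n+[m/n]*n q d) ⟩
    q % d + q / d * d + d ≡⟨ +-assoc (q % d) _ _ ⟩
    q % d + (q / d * d + d) ≡⟨ cong (q % d +_) (+-comm _ d) ⟩
    q % d + suc (q / d) * d ≤⟨ +-monoʳ-≤ (q % d) (*-monoˡ-≤ d quot<) ⟩
    q % d + p / d * d ≡⟨ cong (_+ p / d * d) e ⟨
    p % d + p / d * d ≡⟨ m≡m%n+[m/n]*n p d ⟨
    p ∎
  where
  open ≤-Reasoning
  quot< : q / d < p / d
  quot< = ≰⇒> λ le → <⇒≱ lt (begin
    p ≡⟨ m≡m%n+[m/n]*n p d ⟩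
    p % d + p / d * d ≤⟨ +-mono-≤ (≤-reflexive e) (*-monoˡ-≤ d le) ⟩
    q % d + q / d * d ≡⟨ m≡m%n+[m/n]*n q d ⟨
    q ∎)

-- The value v at minimum m, with t standing for y − 1.
long : ℕ → ℕ → ℕ
long m t = suc t C 2 + ((m ∸ suc t C 2 ∸ 1) % suc t)

U-short : ∀ {n} (H : Hypergraph n) x → minV x ≤ suc (yH H x) C 2 → U H x ≡ tetris H x
U-short H x le with minV x ≤ᵇ suc (yH H x) C 2 | ≤⇒≤ᵇ le
... | true | _ = refl

U-long : ∀ {n} (H : Hypergraph n) x → suc (yH H x) C 2 < minV x → U H x ≡ long (minV x) (yH H x)
U-long H x lt with minV x ≤ᵇ suc (yH H x) C 2 in eq
... | false = refl
... | true = ⊥-elim (<⇒≱ lt (≤ᵇ⇒≤ (minV x) _ (subst T (sym eq) tt)))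

long-≥ : ∀ m t → suc t C 2 ≤ long m t
long-≥ m t = m≤m+n _ _

long-< : ∀ m t → long m t < suc (suc t) C 2
long-< m t = subst (long m t <_) (sym (C2-suc (suc t)))
    (+-monoʳ-< (suc t C 2) (m%n<n (m ∸ suc t C 2 ∸ 1) (suc t)))

long-<-min : ∀ m t → suc t C 2 < m → long m t < m
long-<-min m t lt = begin-strict
    c + (m ∸ c ∸ 1) % suc t ≤⟨ +-monoʳ-≤ c (m%n≤m _ (suc t)) ⟩
    c + (m ∸ c ∸ 1) <⟨ +-monoʳ-< c (≤-reflexive (m+[n∸m]≡n (m<n⇒0<n∸m lt))) ⟩
    c + (m ∸ c) ≡⟨ m+[n∸m]≡n (<⇒≤ lt) ⟩
    m ∎
  where
  open ≤-Reasoning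
  c = suc t C 2

-- `p` is the largest number up to `m` congruent to `k + 1` modulo `l + 1`, hence at most `l` below
-- `m`; the residue in `long p l` is then `k` minus `suc l C 2`.
long-target : ∀ k m l → k < m → suc l C 2 ≤ k → k < suc (suc l) C 2 →
  ∃ λ p → p ≤ m × m ∸ p ≤ l × suc l C 2 < p × long p l ≡ k
long-target k m l k<m lo hi = p , subst (p ≤_) split (m≤m+n p j) , ≤-trans
    (≤-reflexive (trans (cong (_∸ p) (sym split)) (m+n∸m≡n p j))) (≤-pred (m%n<n r η)) ,
    subst (_< p) (+-identityʳ c) (+-monoʳ-< c z<s) ,
    (begin
      c + ((p ∸ c ∸ 1) % η) ≡⟨ cong (λ s → c + (s ∸ 1) % η) (m+n∸m≡n c (suc (q + r / η * η))) ⟩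
      c + ((q + r / η * η) % η) ≡⟨ cong (c +_) ([m+kn]%n≡m%n q (r / η) η) ⟩
      c + q % η ≡⟨ cong (c +_) (m<n⇒m%n≡m q<η) ⟩
      c + q ≡⟨ m+[n∸m]≡n lo ⟩
      k ∎)
  where
  open ≡-Reasoning
  η = suc l
  c = η C 2
  q = k ∸ c
  r = m ∸ suc k
  j = r % η
  p = c + suc (q + r / η * η)
  q<η : q < η
  q<η = +-cancelˡ-< c q η (subst₂ _<_ (sym (m+[n∸m]≡n lo)) (C2-suc η) hi)
  split : p + j ≡ m
  split = begin
    c + suc (q + r / η * η) + j ≡⟨ +-assoc c _ j ⟩
    c + suc (q + r / η * η + j) ≡⟨ cong (λ s → c + suc s)
        (trans (+-assoc q _ j) (cong (q +_) (trans (+-comm _ j) (sym (m≡m%n+[m/n]*n r η))))) ⟩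
    c + suc (q + r) ≡⟨ +-suc c _ ⟩
    suc (c + (q + r)) ≡⟨ cong suc (sym (+-assoc c q r)) ⟩
    suc (c + q + r) ≡⟨ cong (λ s → suc (s + r)) (m+[n∸m]≡n lo) ⟩
    suc k + r ≡⟨ m+[n∸m]≡n k<m ⟩
    m ∎

module Formula {n : ℕ} (H : Hypergraph n) (a : ℕ) (0<a : 0 < a)
  (edge-a : ∀ p → card p ≡ a → H (tabulate p) ≡ true)
  (min-a : ∀ p → H (tabulate p) ≡ true → a ≤ card p)
  (2a≤n : a + a ≤ n) (3≤n : 3 ≤ n)
  (window : ∀ s → s + a < n → ∃ λ d → s < d × d ≤ s + a × (∀ p → card p ≡ d → H (tabulate p) ≡ true))
  (max-a : ∀ p → H (tabulate p) ≡ true → card p + a ≤ n)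
  where

  open Tetris H a 0<a edge-a min-a
  open Sufficiency H a 0<a edge-a min-a 2a≤n 3≤n window

  -- By `max-a` at least `a` piles stay outside a move, and together they provide `k` unit moves
  -- when each has height `k`.
  τ-unmoved : ∀ {k} x w v → Move H x w → (∀ i → supp x w ∌ i → k ≤ lookup v i) → k ≤ τ v
  τ-unmoved x w v (_ , e) h = τ-dense v (∁ (supp x w))
      (+-cancelˡ-≤ (card (supp x w)) a _ (subst (card (supp x w) + a ≤_) (sym (card-∁ (supp x w))) (max-a _ e)))
    λ i i∈ → h i (∁-elim (supp x w) i∈)

  minV-≤τ : ∀ x → minV x ≤ τ x
  minV-≤τ x = τ-dense x full (subst (a ≤_) (sym (card-full n)) a≤n) (λ i _ → minV-≤ x i)

  minV-move : ∀ x w → Move H x w → minV w ≤ minV x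
  minV-move x w (le , _) = let i , e = attained x in ≤-trans (minV-≤ w i) (≤-trans (le i) (≤-reflexive e))

  -- Equal values lie in the same binomial interval, so the shifted Tetris values agree, say with
  -- `t`, and the minima are congruent modulo `t + 1`. If the minima are equal, a move joins the
  -- shifted positions and lowers `τ`. If not, the minimum fell by at least `t + 1`, and the unmoved
  -- piles give `w` a shifted Tetris value above `t`.
  U≢-long : ∀ x w → Move H x w → suc (yH H x) C 2 < minV x → suc (yH H w) C 2 < minV w → U H w ≢ U H x
  U≢-long x w mv@(le , edge) x-long w-long eq = by-min (m≤n⇒m<n∨m≡n (minV-move x w mv))
    where
    t = yH H x
    eq′ : long (minV w) (yH H w) ≡ long (minV x) t
    eq′ = trans (sym (U-long H w w-long)) (trans eq (U-long H x x-long))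
    separate : ∀ m t m′ t′ → t < t′ → long m t ≢ long m′ t′
    separate m t m′ t′ lt e = <⇒≱ (long-< m t) (≤-trans (C2-mono {suc (suc t)} {suc t′} (s≤s lt))
        (≤-trans (long-≥ m′ t′) (≤-reflexive (sym e))))
    same-t : yH H w ≡ t
    same-t with <-cmp (yH H w) t
    ... | tri≈ _ e _ = e
    ... | tri< lt _ _ = ⊥-elim (separate (minV w) _ (minV x) _ lt eq′)
    ... | tri> _ _ gt = ⊥-elim (separate (minV x) _ (minV w) _ gt (sym eq′))
    c = suc t C 2
    c<w : c < minV w
    c<w = subst (λ t → suc t C 2 < minV w) same-t w-long
    residues : (minV x ∸ c ∸ 1) % suc t ≡ (minV w ∸ c ∸ 1) % suc t
    residues = +-cancelˡ-≡ c _ _ (trans (sym eq′) (cong (long (minV w)) same-t))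
    by-min : ¬ (minV w < minV x ⊎ minV w ≡ minV x)
    by-min (inj₂ e) = <⇒≢ (τ-move (shift (minV x) x) (shift (minV x) w) shifted)
        (trans (cong (λ m → τ (shift m w)) (sym e)) same-t)
      where
      m≤w : ∀ i → minV x ≤ lookup w i
      m≤w i = subst (_≤ lookup w i) e (minV-≤ w i)
      shifted : Move H (shift (minV x) x) (shift (minV x) w)
      shifted = (λ i → subst₂ _≤_ (sym (lookup-shift (minV x) w i)) (sym (lookup-shift (minV x) x i))
          (∸-monoˡ-≤ (minV x) (le i))) ,
        trans (cong H (tabulate-cong (supp-≡ (shift (minV x) x) (shift (minV x) w) (supp x w)
          (λ i i∈ → subst₂ _<_ (sym (lookup-shift (minV x) w i)) (sym (lookup-shift (minV x) x i))
              (∸-monoˡ-< (∋-supp x w i∈) (m≤w i)))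
          (λ i i∌ → subst₂ _≤_ (sym (lookup-shift (minV x) x i)) (sym (lookup-shift (minV x) w i))
              (∸-monoˡ-≤ (minV x) (∌-supp x w i∌)))))) edge
    by-min (inj₁ lt) = <⇒≱ (n<1+n (yH H w)) (τ-unmoved x w (shift (minV w) w) mv λ i i∌ →
        subst (suc (yH H w) ≤_) (sym (lookup-shift _ w i))
            (≤-trans (≤-trans (≤-reflexive (cong suc same-t)) gap)
                (∸-monoˡ-≤ (minV w) (≤-trans (minV-≤ x i) (∌-supp x w i∌)))))
      where
      undo : ∀ m → c < m → m ∸ c ∸ 1 + suc c ≡ m
      undo m lt = trans (cong (_+ suc c) (trans (∸-+-assoc m c 1) (cong (m ∸_) (+-comm c 1)))) (m∸n+n≡m lt)
      gap : suc t ≤ minV x ∸ minV w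
      gap = m+n≤o⇒m≤o∸n (suc t)
          (subst₂ _≤_ (trans (+-assoc _ (suc t) (suc c))
              (trans (cong (minV w ∸ c ∸ 1 +_) (+-comm (suc t) (suc c)))
                  (trans (sym (+-assoc _ (suc c) (suc t))) (trans (cong (_+ suc t) (undo (minV w) c<w))
                      (+-comm (minV w) (suc t)))))) (undo (minV x) (<-trans c<w lt))
              (+-monoˡ-≤ (suc c) (congruent-gap (minV x ∸ c ∸ 1) (minV w ∸ c ∸ 1) (suc t) residues
                (∸-monoˡ-< (∸-monoˡ-< lt (<⇒≤ c<w)) (m<n⇒0<n∸m c<w)))))

  U≢ : ∀ x w → Move H x w → U H w ≢ U H x
  U≢ x w mv with <-≤-connex (suc (yH H x) C 2) (minV x) | <-≤-connex (suc (yH H w) C 2) (minV w)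
  ... | inj₁ x-long | inj₁ w-long = U≢-long x w mv x-long w-long
  ... | inj₂ x-short | inj₂ w-short = λ e → <⇒≢ (τ-move x w mv) (trans (sym (U-short H w w-short))
      (trans e (U-short H x x-short)))
  -- In both mixed cases the long value is less than the minimum of its own position, which is a
  -- lower bound for the Tetris value of the other position.
  ... | inj₂ x-short | inj₁ w-long = <⇒≢ (begin-strict
      U H w ≡⟨ U-long H w w-long ⟩
      long (minV w) (yH H w) <⟨ long-<-min (minV w) (yH H w) w-long ⟩
      minV w ≤⟨ minV-move x w mv ⟩
      minV x ≤⟨ minV-≤τ x ⟩
      τ x ≡⟨ U-short H x x-short ⟨
      U H x ∎)
    where open ≤-Reasoning
  ... | inj₁ x-long | inj₂ w-short = >⇒≢ (begin-strict
      U H x ≡⟨ U-long H x x-long ⟩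
      long (minV x) (yH H x) <⟨ long-<-min (minV x) (yH H x) x-long ⟩
      minV x ≤⟨ τ-unmoved x w w mv (λ i i∌ → ≤-trans (minV-≤ x i) (∌-supp x w i∌)) ⟩
      τ w ≡⟨ U-short H w w-short ⟨
      U H w ∎)
    where open ≤-Reasoning

  -- The target has minimum `p`, taken from `long-target`, and shifted Tetris value `l`. The last
  -- premise excludes the case where both would be the same as for `x`, which no move achieves.
  reach-long : ∀ x k l → k < minV x → suc l C 2 ≤ k → k < suc (suc l) C 2 → l ≤ yH H x →
      (l ≡ yH H x → long (minV x) l ≢ k) →
    ∃ λ w → Move H x w × U H w ≡ k
  reach-long x k l k<m lo hi l≤ strict
    with p , p≤m , m∸p≤l , c<p , e ← long-target k (minV x) l k<m lo hi
    with w , mv , mw , τw ← reach-min x p l p≤m m∸p≤l l≤ (λ m≡p → ≤∧≢⇒< l≤ λ l≡ → strict l≡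
        (trans (cong (λ m → long m l) m≡p) e)) =
    w , mv , trans (U-long H w (subst₂ _<_ (cong (λ t → suc t C 2) (sym yw)) (sym mw) c<p))
        (trans (cong₂ long mw yw) e)
    where
    yw : yH H w ≡ l
    yw = trans (cong (λ m → τ (shift m w)) mw) τw

  U-zero-min : ∀ w → minV w ≡ 0 → U H w ≡ τ w
  U-zero-min w e = U-short H w (≤-trans (≤-reflexive e) z≤n)

  τ-excess⇒positive : ∀ x → yH H x < τ x → 0 < minV x
  τ-excess⇒positive x lt = ≰⇒> λ m≤0 → <⇒≱ lt (τ-mono x (shift (minV x) x) λ i →
    ≤-reflexive (sym (trans (lookup-shift _ x i) (cong (lookup x i ∸_) (n≤0⇒n≡0 m≤0)))))

  -- Three ranges: `k` at most `yH H x`, then up to `τ` of the corner, then above it. In the first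
  -- two a zero minimum makes `U` equal to `τ`; in the third the minimum does not grow and `y` does
  -- not fall, so `w` still satisfies the condition of `U-short`.
  reach-short : ∀ x k → minV x ≤ suc (yH H x) C 2 → minV x ≤ k → k < τ x → ∃ λ w → Move H x w × U H w ≡ k
  reach-short x k short m≤k k<τ with <-≤-connex (yH H x) k
  ... | inj₂ k≤ = let w , mv , e , e₀ = reach-zero-min x k m≤k k≤ (λ _ → k<τ) in w , mv ,
                        trans (U-zero-min w e₀) e
  ... | inj₁ y<k with τ-excess⇒positive x (<-trans y<k k<τ) | <-≤-connex (τ (corner x (frame x))) k
  ... | pos | inj₂ k≤ = let w , mv , e , i , e₀ = reach-below-corner x (frame x) pos k m≤k k≤
                        in w , mv , trans (U-zero-min w (minV-unique w i e₀ λ _ → z≤n)) e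
  ... | pos | inj₁ lt = let w , mv , e , m≤ , y≤ = reach-above-corner x (frame x) pos k (<⇒≤ lt) k<τ
                        in w , mv , trans (U-short H w
                            (≤-trans m≤ (≤-trans short (C2-mono {suc (yH H x)} {suc (yH H w)} (s≤s y≤))))) e

  reach : ∀ x k → k < U H x → ∃ λ w → Move H x w × U H w ≡ k
  reach x k k<U with <-≤-connex (suc (yH H x) C 2) (minV x) | C2-root k
  ... | inj₁ x-long | l , lo , hi = reach-long x k l (<-trans k<v (long-<-min (minV x) (yH H x) x-long)) lo hi
          (≤-pred (≤-pred (C2-reflects (≤-<-trans lo (<-trans k<v (long-< (minV x) (yH H x)))))))
          (λ l≡ e → <⇒≢ k<v (trans (sym e) (cong (long (minV x)) l≡)))
    where
    k<v : k < long (minV x) (yH H x)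
    k<v = subst (k <_) (U-long H x x-long) k<U
    C2-reflects : ∀ {y z} → y C 2 < z C 2 → y < z
    C2-reflects {y} {z} lt = ≰⇒> λ le → <⇒≱ lt (C2-mono {z} {y} le)
  ... | inj₂ x-short | l , lo , hi with <-≤-connex k (minV x)
  ... | inj₂ m≤k = reach-short x k x-short m≤k (subst (k <_) (U-short H x x-short) k<U)
  -- Here `k < minV x ≤ suc (yH H x) C 2` forces `l` strictly below `yH H x`, so the exceptional
  -- case of `reach-long` cannot occur.
  ... | inj₁ k<m = reach-long x k l k<m lo hi (<⇒≤ l<) (λ l≡ → ⊥-elim (<⇒≢ l< l≡))
    where
    l< : l < yH H x
    l< = ≰⇒> λ le → <⇒≱ (<-≤-trans k<m x-short) (≤-trans (C2-mono {suc (yH H x)} {suc l} (s≤s le)) lo)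

  U-isSpragueGrundy : IsSpragueGrundy H (U H)
  U-isSpragueGrundy = U≢ , reach

-- Characterisation

subset-of-size : ∀ {n} (p : Pred n) d → d ≤ card p → ∃ λ q → q ⊑ p × card q ≡ d
subset-of-size {n} p d le = go (card p ∸ d) p (m∸n+n≡m le)
  where
  go : ∀ e (p : Pred n) → e + d ≡ card p → ∃ λ q → q ⊑ p × card q ≡ d
  go zero p eq = p , (λ _ → id) , sym eq
  go (suc e) p eq =
    let i , i∈ = card>0 p (subst (0 <_) eq z<s)
        smaller = card-∖ p (single i) λ j j∈ → subst (p ∋_) (single-≡ {i = i} j∈) i∈
        q , q⊑ , c = go e (p ∖ single i)
            (suc-injective (trans eq (trans (sym smaller) (cong (_+ card (p ∖ single i)) (card-single i)))))
    in q , (λ j → proj₁ ∘ ∖-elim p (single i) ∘ q⊑ j) , c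

pigeonhole-∩ : ∀ {n} (p q : Pred n) → n < card p + card q → ∃ λ i → p ∋ i × q ∋ i
pigeonhole-∩ {n} p q lt with 0 <? card (q ∖ ∁ p)
... | yes pos = let i , i∈ = card>0 (q ∖ ∁ p) pos ; i∈q , i∌ = ∖-elim q (∁ p) i∈ in i , double (p i) i∌ , i∈q
  where
  double : ∀ b → not b ≡ false → b ≡ true
  double true _ = refl
... | no none = ⊥-elim (<⇒≱ lt (≤-trans (+-monoʳ-≤ (card p) (card-mono {p = q} {∁ p} λ i i∈ → keep i i∈
    (∋-or-∌ (∁ p) i))) (≤-reflexive (card-∁ p))))
  where
  keep : ∀ i → q ∋ i → ∁ p ∋ i ⊎ ∁ p ∌ i → ∁ p ∋ i
  keep i _ (inj₁ h) = h
  keep i i∈ (inj₂ h) = ⊥-elim (none (card-∋ (q ∖ ∁ p) (∖-intro q (∁ p) i∈ h)))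

∩-intro : ∀ {n} (A B : Subset n) {i} → lookup A ∋ i → lookup B ∋ i → Nonempty (A ∩ B)
∩-intro A B {i} a b = i , x∈p∩q⁺ (lookup⇒[]= i A a , lookup⇒[]= i B b)

∩-elim : ∀ {n} (A B : Subset n) → Nonempty (A ∩ B) → ∃ λ i → lookup A ∋ i × lookup B ∋ i
∩-elim A B (i , i∈) = let a , b = x∈p∩q⁻ A B i∈ in i , []=⇒lookup a , []=⇒lookup b

induced⁺ : ∀ {n} (H : Hypergraph n) S A → H A ≡ true → lookup A ⊑ lookup S → induced H S A ≡ true
induced⁺ H S A e sub with A ⊆? S
... | yes _ rewrite e = refl
... | no ¬sub = ⊥-elim (¬sub λ {i} i∈ → lookup⇒[]= i S (sub i ([]=⇒lookup i∈)))

induced⁻ : ∀ {n} (H : Hypergraph n) S A → induced H S A ≡ true → H A ≡ true × lookup A ⊑ lookup S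
induced⁻ H S A e with H A | A ⊆? S
induced⁻ H S A () | false | _
induced⁻ H S A () | true | no _
... | true | yes sub = refl , λ i i∈ → []=⇒lookup (sub (lookup⇒[]= i A i∈))

least-edge : ∀ {n} (H : Hypergraph n) → NonEmptyH H → ∃ λ A → H A ≡ true × (∀ B → H B ≡ true → ∣ A ∣ ≤ ∣ B ∣)
least-edge H (A , e) = go A e (<-wellFounded _)
  where
  go : ∀ A → H A ≡ true → Acc _<_ ∣ A ∣ → ∃ λ A → H A ≡ true × (∀ B → H B ≡ true → ∣ A ∣ ≤ ∣ B ∣)
  go A e (acc rs) with anySubset? (λ B → (H B Bool.≟ true) ×-dec (∣ B ∣ <? ∣ A ∣))
  ... | yes (B , e′ , lt) = go B e′ (rs lt)
  ... | no none = A , e , λ B e′ → ≮⇒≥ λ lt → none (B , e′ , lt)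

-- `tetris`, `U` and `grundy` read the hypergraph only through `edges`, so equality of these lists
-- transfers their values to a concrete hypergraph, where they can be evaluated.
tetrisF-edges : ∀ {n} (H H′ : Hypergraph n) → edges H ≡ edges H′ → ∀ f x → tetrisF H f x ≡ tetrisF H′ f x
tetrisF-edges H H′ e zero x = refl
tetrisF-edges H H′ e (suc f) x rewrite e = go (edges H′)
  where
  go : ∀ As → foldr (λ A acc → (if allPos A x then suc (tetrisF H f (dec1 A x)) else 0) ⊔ acc) 0 As ≡
              foldr (λ A acc → (if allPos A x then suc (tetrisF H′ f (dec1 A x)) else 0) ⊔ acc) 0 As
  go [] = refl
  go (A ∷ As) = cong₂ (λ t r → (if allPos A x then suc t else 0) ⊔ r)
      (tetrisF-edges H H′ e f (dec1 A x)) (go As)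

U-edges : ∀ {n} (H H′ : Hypergraph n) → edges H ≡ edges H′ → ∀ x → U H x ≡ U H′ x
U-edges H H′ e x = cong₂ (λ t y → if minV x ≤ᵇ suc y C 2 then t else long (minV x) y)
  (tetrisF-edges H H′ e (suc (sumV x)) x) (tetrisF-edges H H′ e (suc (sumV (shift (minV x) x)))
      (shift (minV x) x))

grundyF-edges : ∀ {n} (H H′ : Hypergraph n) → edges H ≡ edges H′ → ∀ f x → grundyF H f x ≡ grundyF H′ f x
grundyF-edges H H′ e zero x = refl
grundyF-edges H H′ e (suc f) x = trans (mex-map-cong _ _ (moves H x) (λ y _ → grundyF-edges H H′ e f y))
  (cong (λ es → mex (map (grundyF H′ f) (concatMap (λ A → decreases A x) es))) e)

two-piles : Hypergraph 2
two-piles (true ∷ false ∷ []) = true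
two-piles (false ∷ true ∷ []) = true
two-piles _ = false

-- Ordinary two-pile NIM fails at (1, 3): the Grundy value is 1 ⊕ 3 = 2, the formula gives 4.
two-piles-not-JM : ∀ H → (∀ A → H A ≡ two-piles A) → ¬ JM H
-- The fuel 5 is `suc (sumV x)`; both values then result from evaluation.
two-piles-not-JM H eq jm = 2≢4 (trans (sym (grundyF-edges H two-piles same 5 x))
    (trans (jm x) (U-edges H two-piles same x)))
  where
  2≢4 : 2 ≢ 4
  2≢4 ()
  x : Position 2
  x = 1 ∷ 3 ∷ []
  same : edges H ≡ edges two-piles
  same = filter-≐ (λ A → H A Bool.≟ true) (λ A → two-piles A Bool.≟ true)
      ((λ {A} → trans (sym (eq A))) , (λ {A} → trans (eq A))) (allSubsets 2)

module Main {n : ℕ} (H : Hypergraph n) (symmetric : Symmetric H) (H⊥ : H ⊥ ≡ false)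
  (A₀ : Subset n) (A₀-edge : H A₀ ≡ true) (A₀-least : ∀ B → H B ≡ true → ∣ A₀ ∣ ≤ ∣ B ∣) where

  a : ℕ
  a = ∣ A₀ ∣

  same-size : ∀ A → H A ≡ true → ∀ p → card p ≡ ∣ A ∣ → H (tabulate p) ≡ true
  same-size A e p c = symmetric A (tabulate p) e (trans (sym c) (sym (card-∣∣ p)))

  edge-a : ∀ p → card p ≡ a → H (tabulate p) ≡ true
  edge-a = same-size A₀ A₀-edge

  min-a : ∀ p → H (tabulate p) ≡ true → a ≤ card p
  min-a p e = subst (a ≤_) (card-∣∣ p) (A₀-least (tabulate p) e)

  lookup-edge : ∀ A → H A ≡ true → H (tabulate (lookup A)) ≡ true
  lookup-edge A e = trans (cong H (tabulate∘lookup A)) e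

  min-a-lookup : ∀ A → H A ≡ true → a ≤ card (lookup A)
  min-a-lookup A e = min-a (lookup A) (lookup-edge A e)

  0<a : 0 < a
  0<a = subst (0 <_) (card-lookup A₀) (edge-nonempty H H⊥ (lookup A₀) (lookup-edge A₀ A₀-edge))

  open Tetris H a 0<a edge-a min-a

  -- An edge of more than `n - a` elements would meet every edge, since none has fewer than `a`, and
  -- so would be a transversal.
  max-a : TransversalFree H → ∀ p → H (tabulate p) ≡ true → card p + a ≤ n
  max-a free p e = ≮⇒≥ λ lt → free (tabulate p) e λ B e′ →
    let i , i∈p , i∈B = pigeonhole-∩ p (lookup B) (<-≤-trans lt (+-monoʳ-≤ (card p) (min-a-lookup B e′)))
    in ∩-intro (tabulate p) B (trans (lookup∘tabulate p i) i∈p) i∈B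

  2a≤n : TransversalFree H → a + a ≤ n
  2a≤n free = subst (λ c → c + a ≤ n) (card-lookup A₀) (max-a free (lookup A₀) (lookup-edge A₀ A₀-edge))

  -- If no edge size lay in the window, take `S` with `s + a` elements. Every edge inside `S` has at
  -- most `s` of them, so it leaves `a` elements of `S`, which form a disjoint edge. The hypergraph
  -- induced on `S` would be transversal-free, against minimality; `s + a < n` makes `S` proper.
  window : MinimalTransversalFree H → ∀ s → s + a < n → ∃ λ d → s < d × d ≤ s + a × (∀ p → card p ≡ d →
      H (tabulate p) ≡ true)
  window (_ , minimal) s lt with anySubset? (λ B → (H B Bool.≟ true) ×-dec (s <? ∣ B ∣) ×-dec (∣ B ∣ ≤? s + a))
  ... | yes (B , e , lo , hi) = ∣ B ∣ , lo , hi , same-size B e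
  ... | no none with S , _ , cS ← subset-of-size (full {n}) (s + a)
      (≤-trans (<⇒≤ lt) (≤-reflexive (sym (card-full n)))) =
    ⊥-elim (minimal (tabulate S) proper (tabulate (proj₁ base) , base-induced) free)
    where
    proper : ¬ (tabulate S ≡ ⊤)
    proper e = <⇒≢ lt (trans (sym cS) (trans (sym (card-∣∣ S)) (trans (cong ∣_∣ e) (∣⊤∣≡n n))))
    into : ∀ q → q ⊑ S → H (tabulate q) ≡ true → induced H (tabulate S) (tabulate q) ≡ true
    into q q⊑S e = induced⁺ H (tabulate S) (tabulate q) e λ i i∈ → trans (lookup∘tabulate S i)
        (q⊑S i (trans (sym (lookup∘tabulate q i)) i∈))
    base : ∃ λ q → q ⊑ S × card q ≡ a
    base = subset-of-size S a (subst (a ≤_) (sym cS) (m≤n+m a s))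
    base-induced : induced H (tabulate S) (tabulate (proj₁ base)) ≡ true
    base-induced = into (proj₁ base) (proj₁ (proj₂ base)) (edge-a _ (proj₂ (proj₂ base)))
    free : TransversalFree (induced H (tabulate S))
    free A e transversal =
      let B , B⊑ , cB = subset-of-size (S ∖ lookup A) a room
          i , i∈A , i∈B = ∩-elim A (tabulate B) (transversal (tabulate B)
              (into B (λ j → proj₁ ∘ ∖-elim S (lookup A) ∘ B⊑ j) (edge-a B cB)))
      in ∌⇒¬∋ (lookup A) (proj₂ (∖-elim S (lookup A) (B⊑ i (trans (sym (lookup∘tabulate B i)) i∈B)))) i∈A
      where
      A-edge : H A ≡ true
      A-edge = proj₁ (induced⁻ H (tabulate S) A e)
      A⊑S : lookup A ⊑ S
      A⊑S i i∈ = trans (sym (lookup∘tabulate S i)) (proj₂ (induced⁻ H (tabulate S) A e) i i∈)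
      small : card (lookup A) ≤ s
      small = ≮⇒≥ λ s< → none (A , A-edge , subst (s <_) (card-lookup A) s< , subst₂ _≤_
          (card-lookup A) cS (card-mono {p = lookup A} {S} A⊑S))
      room : a ≤ card (S ∖ lookup A)
      room = +-cancelˡ-≤ (card (lookup A)) a _ (≤-trans (+-monoˡ-≤ a small)
          (≤-reflexive (sym (trans (card-∖ S (lookup A) A⊑S) cS))))

  sufficient : MinimalTransversalFree H → 3 ≤ n → JM H
  sufficient mtf 3≤n = sg-unique H H⊥ (grundy-isSpragueGrundy H H⊥) U-isSpragueGrundy
    where
    open Formula H a 0<a edge-a min-a (2a≤n (proj₁ mtf)) 3≤n (window mtf) (max-a (proj₁ mtf))

  -- Necessity: consequences of the JM property

  module _ (jm : JM H) (0<n : 0 < n) where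

    indicator : Pred n → Position n
    indicator S = tabulate (λ i → ⟦ S i ⟧)

    lookup-indicator : ∀ S {i} → S ∋ i → lookup (indicator S) i ≡ 1
    lookup-indicator S {i} e = trans (lookup∘tabulate _ i) (cong ⟦_⟧ e)

    indicator-positive : ∀ S i → 0 < lookup (indicator S) i → S ∋ i
    indicator-positive S i lt = go (S i) (subst (0 <_) (lookup∘tabulate _ i) lt)
      where
      go : ∀ b → 0 < ⟦ b ⟧ → b ≡ true
      go true _ = refl

    U-indicator-full : U H (indicator full) ≡ 0
    -- Here `m = 1` and `y = 1`, so the threshold `1 C 2` is 0 and the residue is taken modulo 1.
    U-indicator-full = trans (U-long H e (subst₂ _<_ (cong (λ y → suc y C 2) (sym y≡0)) (sym m≡1) z<s))
        (cong₂ long m≡1 y≡0)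
      where
      e = indicator full
      i = proj₁ (card>0 (full {n}) (subst (0 <_) (sym (card-full n)) 0<n))
      m≡1 : minV e ≡ 1
      m≡1 = minV-unique e i (lookup∘tabulate _ i) λ j → ≤-reflexive (sym (lookup∘tabulate _ j))
      y≡0 : yH H e ≡ 0
      y≡0 = n≤0⇒n≡0 (≮⇒≥ λ lt → <⇒≱ (subst (_< a) (sym (card-∅ n)) 0<a) (τ-sparse (shift (minV e) e) ∅
        (λ j _ → trans (lookup-shift (minV e) e j) (cong₂ _∸_ (lookup∘tabulate _ j) m≡1)) lt))

    transversal-free : TransversalFree H
    transversal-free A e transversal = proj₁ (grundy-isSpragueGrundy H H⊥)
        x w mv (trans w-terminal (sym (trans (jm x) U-indicator-full)))
      where
      x = indicator full
      w = zeroOn (lookup A) x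
      mv : Move H x w
      mv = zeroOn-≤ (lookup A) x , trans (cong H (tabulate-cong (supp-≡ x w (lookup A)
          (λ i i∈ → subst₂ _<_ (sym (zeroOn-∋ (lookup A) x i∈)) (sym (lookup∘tabulate _ i)) z<s)
          (λ i i∌ → ≤-reflexive (sym (zeroOn-∌ (lookup A) x i∌)))))) (lookup-edge A e)
      w-terminal : grundy H w ≡ 0
      -- A further move would use an edge, which meets the transversal `A` and hence contains an
      -- emptied pile.
      w-terminal = n≤0⇒n≡0 (≮⇒≥ λ lt →
        let v , (_ , e′) , _ = proj₂ (grundy-isSpragueGrundy H H⊥) w 0 lt
            i , i∈A , i∈B = ∩-elim A (tabulate (supp w v)) (transversal _ e′)
        in <⇒≱ (∋-supp w v (trans (sym (lookup∘tabulate (supp w v) i)) i∈B))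
            (≤-trans (≤-reflexive (zeroOn-∋ (lookup A) x i∈A)) z≤n))

    -- At the indicator of `S` some pile is empty, so `U` equals `τ`, which is positive, and some
    -- move leads to Grundy value 0. There `τ` is 0 as well, so no edge inside `S` is left
    -- untouched: the edge moved is a transversal of the induced hypergraph.
    minimal : ∀ S → ¬ (S ≡ ⊤) → NonEmptyH (induced H S) → ¬ TransversalFree (induced H S)
    minimal S S≢⊤ (B , B-induced) free =
      let w , mv , e = proj₂ (grundy-isSpragueGrundy H H⊥) x 0 (subst (0 <_)
            (sym (trans (jm x) (U-at-zero x gap-empty))) 0<τ)
      in free (tabulate (supp x w))
           (induced⁺ H S _ (proj₂ mv) λ i i∈ → indicator-positive (lookup S) i
             (≤-<-trans z≤n (∋-supp x w (trans (sym (lookup∘tabulate (supp x w) i)) i∈))))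
           (meets w mv e)
      where
      x = indicator (lookup S)
      gap : ∃ λ i → lookup S ∌ i
      gap = card-gap (lookup S) (≤∧≢⇒< (card-≤n (lookup S))
          λ c → S≢⊤ (∣p∣≡n⇒p≡⊤ (trans (sym (card-lookup S)) c)))
      gap-empty : lookup x (proj₁ gap) ≡ 0
      gap-empty = trans (lookup∘tabulate _ (proj₁ gap)) (cong ⟦_⟧ (proj₂ gap))
      U-at-zero : ∀ w {i} → lookup w i ≡ 0 → U H w ≡ τ w
      U-at-zero w {i} e = U-short H w (≤-trans (≤-reflexive (minV-unique w i e λ _ → z≤n)) z≤n)
      0<τ-on : ∀ w D → induced H S D ≡ true → (∀ i → lookup D ∋ i → lookup x i ≤ lookup w i) → 0 < τ w
      0<τ-on w D D-induced le = let D-edge , D⊑S = induced⁻ H S D D-induced in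
        τ-dense w (lookup D) (min-a-lookup D D-edge) λ i i∈ → ≤-trans
            (≤-reflexive (sym (lookup-indicator (lookup S) (D⊑S i i∈)))) (le i i∈)
      0<τ : 0 < τ x
      0<τ = 0<τ-on x B B-induced λ _ _ → ≤-refl
      meets : ∀ w → Move H x w → grundy H w ≡ 0 → ∀ D → induced H S D ≡ true → Nonempty
          (tabulate (supp x w) ∩ D)
      meets w (le , _) e D D-induced with nonempty? (tabulate (supp x w) ∩ D)
      ... | yes h = h
      ... | no h = ⊥-elim (>⇒≢ (0<τ-on w D D-induced λ i i∈ → ∌-supp x w (¬∋⇒∌ (supp x w) λ i∈′ →
                h (∩-intro (tabulate (supp x w)) D (trans (lookup∘tabulate (supp x w) i) i∈′) i∈)))
              (trans (sym (U-at-zero w (n≤0⇒n≡0 (≤-trans (le (proj₁ gap)) (≤-reflexive gap-empty)))))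
                  (trans (sym (jm w)) e)))

-- The bound `a + a ≤ 2` forces `a = 1`, `max-a` excludes the two-element set, and symmetry makes
-- both singletons edges.
edges-two : (H : Hypergraph 2) → Symmetric H → H ⊥ ≡ false → NonEmptyH H → TransversalFree H → ∀ A →
    H A ≡ two-piles A
edges-two H symmetric H⊥ ne free = λ where
    (true ∷ true ∷ []) → ¬∋⇒∌ {n = 1} (λ _ → H (true ∷ true ∷ [])) {zero} λ e → <⇒≱ 2<3
        (≤-trans (+-monoʳ-≤ 2 0<a) (max-a free (λ _ → true) e))
    (true ∷ false ∷ []) → single-edge (true ∷ false ∷ []) refl
    (false ∷ true ∷ []) → single-edge (false ∷ true ∷ []) refl
    (false ∷ false ∷ []) → H⊥
  where
  least = least-edge H ne
  open Main H symmetric H⊥ (proj₁ least) (proj₁ (proj₂ least)) (proj₂ (proj₂ least))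
  2<3 : 2 < 3
  2<3 = ≤-refl
  a≡1 : a ≡ 1
  a≡1 = ≤-antisym (≮⇒≥ λ lt → <⇒≱ (≤-trans (s≤s (s≤s (s≤s z≤n))) (+-mono-≤ lt lt)) (2a≤n free)) 0<a
  single-edge : ∀ A → ∣ A ∣ ≡ 1 → H A ≡ true
  single-edge A c = symmetric _ A (proj₁ (proj₂ least)) (trans a≡1 (sym c))

theorem1 : (n : ℕ) → 1 ≤ n → (H : Hypergraph n) → Symmetric H → NonEmptyH H → H ⊥ ≡ false →
    (JM H ⇔ (MinimalTransversalFree H × 3 ≤ n))
theorem1 n 1≤n H symmetric ne H⊥ = mk⇔ (λ jm → (transversal-free jm 1≤n , minimal jm 1≤n) ,
    at-least-three n H symmetric ne H⊥ jm (transversal-free jm 1≤n) (2a≤n (transversal-free jm 1≤n)) 0<a)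
    λ { (mtf , 3≤n) → sufficient mtf 3≤n }
  where
  least = least-edge H ne
  open Main H symmetric H⊥ (proj₁ least) (proj₁ (proj₂ least)) (proj₂ (proj₂ least))
  -- Generalised over `n` and `H` to allow a case split on `n`: the bound `a + a ≤ n` rules out 0
  -- and 1, and for 2 only ordinary NIM remains.
  at-least-three : ∀ n (H : Hypergraph n) → Symmetric H → NonEmptyH H → H ⊥ ≡ false → JM H →
      TransversalFree H → ∀ {a} → a + a ≤ n → 0 < a → 3 ≤ n
  at-least-three 0 H _ _ _ _ _ le pos with () ← ≤-trans pos (≤-trans (m≤m+n _ _) le)
  at-least-three 1 H _ _ _ _ _ le pos with s≤s () ← ≤-trans (+-mono-≤ pos pos) le
  at-least-three 2 H symmetric ne H⊥ jm free _ _ =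
      ⊥-elim (two-piles-not-JM H (edges-two H symmetric H⊥ ne free) jm)
  at-least-three (suc (suc (suc n))) H _ _ _ _ _ _ _ = s≤s (s≤s (s≤s z≤n))
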